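{- Let $\varepsilon > 0$ be a real number and let $d \geq 2$ be an integer. Let $p = p(n) = \omega(1)/n$, i.e. $p = f(n)/n$ for some function $f$ with $f(n) \to \infty$. For each $n$, let $T$ be a tree on at most $(1-\varepsilon)n$ vertices with maximum degree at most $d$. Let $G \sim \mathbb{G}(n,p)$ and let $\psi$ be an $n$-uniform colouring of $G$. Then asymptotically almost surely $(G,\psi)$ admits a $\psi$-rainbow copy of $T$, i.e. a subgraph of $G$ isomorphic to $T$ all of whose edges receive distinct colours under $\psi$.
   Context: $\mathbb{G}(n,p)$ denotes the binomial random graph on vertex set $[n]$ in which each pair is an edge independently with probability $p$. An edge colouring of a graph $G$ is $k$-uniform if the colour of every edge is chosen independently and uniformly at random from a fixed palette of size $k$ (here $[k]$). A subgraph $H$ of an edge-coloured graph is $\psi$-rainbow if all its edges have pairwise distinct colours. "Asymptotically almost surely" (a.a.s.) means with probability tending to $1$ as $n \to \infty$.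
   Formalization: The real number ε and the edge probabilities p(n) are taken to be rational numbers (with 0 ≤ p(n) ≤ 1). -}

module Defs where

open import Data.Bool using (Bool; true; false; if_then_else_; _∧_; _∨_)
open import Data.Nat as ℕ using (ℕ; zero; suc)
open import Data.Integer using (ℤ; +_)
open import Data.Fin as Fin using (Fin; toℕ; inject₁; fromℕ; _≟_; _<?_)
open import Data.List using (List; []; _∷_; filter; filterᵇ; cartesianProduct; allFin; length; map; foldr; zip)
open import Data.Vec as Vec using (Vec; toList)
open import Data.Maybe using (Maybe; just; nothing)
open import Data.Product using (Σ; _×_; _,_; ∃; ∃-syntax; proj₁; proj₂)
open import Data.Sum using (_⊎_)
open import Data.Rational as ℚ using (ℚ; 0ℚ; 1ℚ; _/_)
open import Relation.Binary.PropositionalEquality using (_≡_)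
open import Relation.Nullary.Decidable using (⌊_⌋)
open import Function.Definitions using (Injective)

record Graph (k : ℕ) : Set where
  field
    adj    : Fin k → Fin k → Bool
    sym    : ∀ u v → adj u v ≡ adj v u
    irrefl : ∀ u → adj u u ≡ false

open Graph public

Adj : ∀ {k} → Graph k → Fin k → Fin k → Set
Adj G u v = adj G u v ≡ true

data Walk {k} (G : Graph k) : Fin k → Fin k → Set where
  here : ∀ {u} → Walk G u u
  step : ∀ {u v w} → Adj G u v → Walk G v w → Walk G u w

Connected : ∀ {k} → Graph k → Set
Connected G = ∀ u v → Walk G u v

record Cycle {k} (G : Graph k) : Set where
  field
    len    : ℕ
    vert   : Fin (3 ℕ.+ len) → Fin k
    inj    : Injective _≡_ _≡_ vert
    consec : ∀ (i : Fin (2 ℕ.+ len)) → Adj G (vert (inject₁ i)) (vert (Fin.suc i))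
    close  : Adj G (vert (fromℕ (2 ℕ.+ len))) (vert Fin.zero)

Acyclic : ∀ {k} → Graph k → Set
Acyclic G = Cycle G → Data.Empty.⊥
  where import Data.Empty

IsTree : ∀ {k} → Graph k → Set
IsTree G = Connected G × Acyclic G

degree : ∀ {k} → Graph k → Fin k → ℕ
degree {k} G v = length (filterᵇ (adj G v) (allFin k))

MaxDegreeAtMost : ∀ {k} → Graph k → ℕ → Set
MaxDegreeAtMost {k} G d = ∀ v → degree G v ℕ.≤ d

-- The probability space of G(n,p) together with an n-uniform colouring.
-- An outcome assigns to every pair {i,j} (i < j) of [n] either
-- nothing (non-edge) or just c (edge with colour c ∈ Fin n).

pairs : (n : ℕ) → List (Fin n × Fin n)
pairs n = filter (λ ij → proj₁ ij <? proj₂ ij) (cartesianProduct (allFin n) (allFin n))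

Outcome : ℕ → Set
Outcome n = Vec (Maybe (Fin n)) (length (pairs n))

findCol : ∀ {n} → List ((Fin n × Fin n) × Maybe (Fin n)) → Fin n → Fin n → Maybe (Fin n)
findCol [] u v = nothing
findCol (((i , j) , c) ∷ rest) u v =
  if (⌊ i ≟ u ⌋ ∧ ⌊ j ≟ v ⌋) ∨ (⌊ i ≟ v ⌋ ∧ ⌊ j ≟ u ⌋) then c else findCol rest u v

edgeCol : ∀ {n} → Outcome n → Fin n → Fin n → Maybe (Fin n)
edgeCol {n} ω u v = findCol (zip (pairs n) (toList ω)) u v

coordWeight : (n : ℕ) → ℚ → Maybe (Fin n) → ℚ
coordWeight n p nothing = 1ℚ ℚ.- p
coordWeight zero p (just ())
coordWeight (suc m) p (just _) = p ℚ.* ((+ 1) / suc m)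

weight : (n : ℕ) → ℚ → Outcome n → ℚ
weight n p ω = foldr ℚ._*_ 1ℚ (map (coordWeight n p) (toList ω))

totalWeight : (n : ℕ) → ℚ → List (Outcome n) → ℚ
totalWeight n p L = foldr ℚ._+_ 0ℚ (map (weight n p) L)

record RainbowCopy {k n} (T : Graph k) (ω : Outcome n) : Set where
  field
    φ      : Fin k → Fin n
    φ-inj  : Injective _≡_ _≡_ φ
    col    : ∀ u v → Adj T u v → Fin n
    isEdge : ∀ u v (a : Adj T u v) → edgeCol ω (φ u) (φ v) ≡ just (col u v a)
    rainbow : ∀ u v u′ v′ (a : Adj T u v) (a′ : Adj T u′ v′) →
              col u v a ≡ col u′ v′ a′ →
              (u ≡ u′ × v ≡ v′) ⊎ (u ≡ v′ × v ≡ u′)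

{-# OPTIONS --safe #-}
module Submission where

-- Idea.  Two reductions and one deterministic embedding theorem.
--
-- (1) Rainbow to uncoloured.  Replace, one pair at a time, "present with
-- probability p, with a uniform colour" by "present with probability q = p / t,
-- with no colour", where t ε ≥ 1.  Fix everything else: if the pair matters, then
-- some copy of T uses it, the other edges of that copy carry at most (1 - ε) n
-- colours, and so a fresh random colour completes the copy with probability at
-- least ε ≥ 1 / t.  Hence the coloured graph with density p is at least as likely
-- to contain a rainbow copy as the uncoloured one with density q is to contain a copy.
--
-- (2) Joinedness.  Put m = n / s for a large constant s.  By the union bound, with
-- probability at least 1 - 4^n (1 - q)^(m²) any two disjoint sets of m vertices
-- are joined by an edge, and this tends to 1 as n q → ∞.
--
-- (3) A joined graph contains T (Friedman–Pippenger, Haxell).  Remove a set of at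
-- most m vertices so that small sets expand, and embed T one leaf at a time, keeping
-- the Hall condition r(U) ≤ |N(U) ∩ W| for all |U| ≤ 2m, where W is the set of
-- unused vertices and r(x) the number of children that x may still receive.  If no
-- neighbour y of s can be used, each y has a tight set seeing y; tight sets have at
-- most m vertices by joinedness, so they are closed under union by
-- submodularity, and the union together with s violates the condition.

-- The host graph itself need not expand: when np grows slowly there are isolated vertices, and
-- joinedness speaks only of sets of linear size. The pruning in (3) repairs this at the price of m
-- vertices, a small part of the εn vertices that T leaves free.
--
-- The comparison in (1) knows nothing of trees. It concerns a fixed family of coordinate lists of
-- bounded length and the event that one of them is present with distinct colours. Intermediate
-- stages of the exchange mix coloured and uncoloured pairs, so both models are mapped to one
-- alphabet that has an extra symbol for an edge without colour.
--
-- The slack ε is spent twice, each time in the form n - k ≥ n / t: it bounds from below the colours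
-- that a copy leaves free and the vertices that the embedding may waste. The embedding wastes (3d +
-- 7)m vertices, hence s = (3d + 7)t. The product nq then only has to beat a constant that ensures 2
-- · 16^s (1 - q)^m ≤ 1; the m-th power of this outweighs the 4^n pairs of vertex sets and leaves a
-- failure probability of at most 2^(-m).

module Embedding where

  open import Data.Bool using (Bool; true; false; _∧_; _∨_; not; if_then_else_)
  import Data.Bool as Bool
  open import Data.Bool.Properties using (∧-conicalˡ; ∧-conicalʳ; ∧-identityʳ; ∧-zeroʳ; ∨-zeroʳ; ¬-not)
  open import Data.Fin using (Fin; zero; suc)
  import Data.Fin as Fin
  open import Data.Fin.Properties using (any?)
  open import Data.Fin.Subset using (Subset)
  open import Data.Fin.Subset.Properties using (anySubset?)
  open import Data.List using (List; []; _∷_; allFin)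
  open import Data.List.Membership.Propositional using (_∈_)
  open import Data.List.Membership.Propositional.Properties using (∈-allFin)
  open import Data.List.Relation.Unary.Any using (here; there)
  open import Data.Nat using (ℕ; zero; suc; _+_; _*_; _∸_; _≤_; _<_; z≤n; s≤s; _≤?_; _<?_)
  open import Data.Nat.Properties
  open import Data.Nat.Solver using (module +-*-Solver)
  open import Data.Product using (_×_; _,_; ∃; ∃-syntax; proj₁; proj₂)
  open import Data.Sum using (inj₁; inj₂)
  open import Data.Vec using (lookup; tabulate)
  open import Data.Vec.Properties using (lookup∘tabulate)
  open import Function using (_∘_)
  open import Relation.Binary.PropositionalEquality
  open import Relation.Nullary using (¬_; Dec; yes; no; contradiction)
  open import Relation.Nullary.Decidable using (⌊_⌋; _×-dec_; ¬?)
  open import Algebra.Properties.CommutativeMonoid.Sum +-0-commutativeMonoid using (sum; ∑-distrib-+; sum-cong-≗)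
  open import Algebra.Properties.Semiring.Sum +-*-semiring using (*-distribˡ-sum)

  private variable n : ℕ

  -- Sums over `Fin n` and counting with Boolean predicates

  sum-mono : {f g : Fin n → ℕ} → (∀ i → f i ≤ g i) → sum f ≤ sum g
  sum-mono {zero}  f≤g = z≤n
  sum-mono {suc n} f≤g = +-mono-≤ (f≤g zero) (sum-mono (f≤g ∘ suc))

  sum-mono₁₂ : {f g h : Fin n → ℕ} → (∀ i → f i ≤ g i + h i) → sum f ≤ sum g + sum h
  sum-mono₁₂ {g = g} {h} p = ≤-trans (sum-mono p) (≤-reflexive (∑-distrib-+ g h))

  sum-zero : {f : Fin n → ℕ} → (∀ i → f i ≡ 0) → sum f ≡ 0
  sum-zero {zero}  f≡0 = refl
  sum-zero {suc n} f≡0 = cong₂ _+_ (f≡0 zero) (sum-zero (f≡0 ∘ suc))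

  ≤sum : (f : Fin n → ℕ) → ∀ i → f i ≤ sum f
  ≤sum f zero    = m≤m+n _ _
  ≤sum f (suc i) = ≤-trans (≤sum (f ∘ suc) i) (m≤n+m _ _)

  sum-point : (f : Fin n → ℕ) (i : Fin n) → (∀ j → j ≢ i → f j ≡ 0) → sum f ≡ f i
  sum-point {suc n} f zero z = trans (cong (f zero +_) (sum-zero λ j → z (suc j) λ ())) (+-identityʳ _)
  sum-point {suc n} f (suc i) z =
    cong₂ _+_ (z zero λ ()) (sum-point (f ∘ suc) i λ j j≢i → z (suc j) (λ { refl → j≢i refl }))

  sum-positive : (f : Fin n → ℕ) → 0 < sum f → ∃[ i ] 0 < f i
  sum-positive {suc n} f pos with f zero in eq
  ... | suc _ = zero , subst (0 <_) (sym eq) (s≤s z≤n)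
  ... | zero  with sum-positive (f ∘ suc) pos
  ...   | i , p = suc i , p

  ι : Bool → ℕ
  ι true  = 1
  ι false = 0

  count : (Fin n → Bool) → ℕ
  count f = sum (ι ∘ f)

  -- Sets that have to be searched for are `Subset`s, which `anySubset?` can enumerate; sets that
  -- are only counted stay Boolean functions.
  size : Subset n → ℕ
  size U = count (lookup U)

  mass : (Fin n → ℕ) → Subset n → ℕ
  mass r U = sum (λ v → if lookup U v then r v else 0)

  ι≤1 : ∀ b → ι b ≤ 1
  ι≤1 true  = s≤s z≤n
  ι≤1 false = z≤n

  ι-mono : ∀ {a b} → (a ≡ true → b ≡ true) → ι a ≤ ι b
  ι-mono {false} f = z≤n
  ι-mono {true} {b} f rewrite f refl = ≤-refl

  ι-cover : ∀ {a b c} → (a ≡ true → b ≡ false → c ≡ true) → ι a ≤ ι b + ι c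
  ι-cover {false} f = z≤n
  ι-cover {true} {true} f = s≤s z≤n
  ι-cover {true} {false} f rewrite f refl refl = ≤-refl

  -- Submodularity at a single vertex: `a` and `b` stand for membership in the neighbourhoods of a
  -- union and an intersection, `c` and `d` for membership in those of the two sets.
  ι-submodular : ∀ {a b c d} → (a ≡ true → c ≡ false → d ≡ true) →
    (b ≡ true → c ≡ true) → (b ≡ true → d ≡ true) → ι a + ι b ≤ ι c + ι d
  ι-submodular {a} {false} {c} {d} f g h = subst (_≤ ι c + ι d) (sym (+-identityʳ (ι a))) (ι-cover {a} {c} {d} f)
  ι-submodular {a} {true} f g h rewrite g refl | h refl = +-monoˡ-≤ 1 (ι≤1 a)

  ι-remove : ∀ b c → ι b ≤ ι c + ι (b ∧ not c)
  ι-remove false c = z≤n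
  ι-remove true false = ≤-refl
  ι-remove true true = ≤-refl

  count-not : (f : Fin n → Bool) → count f + count (not ∘ f) ≡ n
  count-not {zero}  f = refl
  count-not {suc n} f with f zero
  ... | true  = cong suc (count-not (f ∘ suc))
  ... | false = trans (+-suc _ _) (cong suc (count-not (f ∘ suc)))

  ι-positive : ∀ {b} → 0 < ι b → b ≡ true
  ι-positive {true} _ = refl

  _∪_ _∩_ : Subset n → Subset n → Subset n
  U ∪ V = tabulate λ v → lookup U v ∨ lookup V v
  U ∩ V = tabulate λ v → lookup U v ∧ lookup V v

  ∪≡ : (U V : Subset n) → ∀ v → lookup (U ∪ V) v ≡ lookup U v ∨ lookup V v
  ∪≡ U V = lookup∘tabulate _

  ∩≡ : (U V : Subset n) → ∀ v → lookup (U ∩ V) v ≡ lookup U v ∧ lookup V v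
  ∩≡ U V = lookup∘tabulate _

  _is_ : Fin n → Fin n → Bool
  u is v = ⌊ u Fin.≟ v ⌋

  is-refl : (v : Fin n) → (v is v) ≡ true
  is-refl v with v Fin.≟ v
  ... | yes _ = refl
  ... | no v≢v = contradiction refl v≢v

  is-no : {u v : Fin n} → u ≢ v → (u is v) ≡ false
  is-no {u = u} {v} u≢v with u Fin.≟ v
  ... | yes p = contradiction p u≢v
  ... | no _ = refl

  is-yes : {u v : Fin n} → (u is v) ≡ true → u ≡ v
  is-yes {u = u} {v} e with u Fin.≟ v
  ... | yes p = p

  count-is : (x : Fin n) → count (_is x) ≡ 1
  count-is x = trans (sum-point _ x λ y y≢x → cong ι (is-no y≢x)) (cong ι (is-refl x))

  ⁅_⁆ : Fin n → Subset n
  ⁅ s ⁆ = tabulate (_is s)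

  ∅ : Subset n
  ∅ = tabulate λ _ → false

  size-∪ : (U V : Subset n) → size (U ∪ V) ≤ size U + size V
  size-∪ U V = sum-mono₁₂ λ v → subst (λ b → ι b ≤ ι (lookup U v) + ι (lookup V v)) (sym (∪≡ U V v))
      (lem (lookup U v) (lookup V v))
    where
    lem : ∀ a b → ι (a ∨ b) ≤ ι a + ι b
    lem true  b = s≤s z≤n
    lem false b = ≤-refl

  size-⁅⁆ : (s : Fin n) → size ⁅ s ⁆ ≡ 1
  size-⁅⁆ s = trans (sum-cong-≗ λ v → cong ι (lookup∘tabulate (_is s) v)) (count-is s)

  size-∅ : size {n} ∅ ≡ 0
  size-∅ {n} = sum-zero {n} λ i → cong ι (lookup∘tabulate _ i)

  mass-modular : (r : Fin n → ℕ) (U V : Subset n) → mass r (U ∪ V) + mass r (U ∩ V) ≡ mass r U + mass r V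
  mass-modular {n} r U V =
    trans (sym (∑-distrib-+ {n} _ _)) (trans (sum-cong-≗ pt) (∑-distrib-+ {n} _ _))
    where
    lem : ∀ a b x → (if a ∨ b then x else 0) + (if a ∧ b then x else 0) ≡ (if a then x else 0) + (if b then x else 0)
    lem true  b x = refl
    lem false b x = +-identityʳ _
    pt : ∀ v → (if lookup (U ∪ V) v then r v else 0) + (if lookup (U ∩ V) v then r v else 0) ≡
               (if lookup U v then r v else 0) + (if lookup V v then r v else 0)
    pt v rewrite ∪≡ U V v | ∩≡ U V v = lem (lookup U v) (lookup V v) (r v)

  mass-bound : (r : Fin n → ℕ) (D : ℕ) → (∀ v → r v ≤ D) → ∀ U → mass r U ≤ D * size U
  mass-bound {n} r D r≤D U =
    subst (mass r U ≤_) (sym (*-distribˡ-sum {n} D _)) (sum-mono λ v → pt (lookup U v) v)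
    where
    pt : ∀ b v → (if b then r v else 0) ≤ D * ι b
    pt true v  = ≤-trans (r≤D v) (≤-reflexive (sym (*-identityʳ D)))
    pt false v = z≤n

  -- Neighbourhoods, joinedness and the Hall condition

  module Neighbourhood (adj : Fin n → Fin n → Bool) where

    N : Subset n → Fin n → Bool
    N U v = ⌊ any? (λ u → (lookup U u ∧ adj u v) Bool.≟ true) ⌋

    N-intro : ∀ U {u v} → lookup U u ≡ true → adj u v ≡ true → N U v ≡ true
    N-intro U {u} {v} p q with any? (λ u → (lookup U u ∧ adj u v) Bool.≟ true)
    ... | yes _ = refl
    ... | no ¬e = contradiction (u , trans (cong₂ _∧_ p q) refl) ¬e

    N-elim : ∀ U {v} → N U v ≡ true → ∃[ u ] (lookup U u ≡ true × adj u v ≡ true)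
    N-elim U {v} e with any? (λ u → (lookup U u ∧ adj u v) Bool.≟ true)
    ... | yes (u , p) = u , ∧-conicalˡ _ _ p , ∧-conicalʳ _ _ p

    N-mono : ∀ U V {v} → (∀ u → lookup U u ≡ true → lookup V u ≡ true) → N U v ≡ true → N V v ≡ true
    N-mono U V sub e with N-elim U e
    ... | u , p , q = N-intro V (sub u p) q

    N-∪ : ∀ U V {v} → N (U ∪ V) v ≡ true → N U v ≡ false → N V v ≡ true
    N-∪ U V {v} e ¬U with N-elim (U ∪ V) e
    ... | u , p , q with lookup U u in eq
    ...   | true  = contradiction (trans (sym (N-intro U eq q)) ¬U) λ ()
    ...   | false = N-intro V (trans (sym (trans (∪≡ U V u) (cong (_∨ lookup V u) eq))) p) q

    nbr : Subset n → (Fin n → Bool) → Fin n → Bool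
    nbr U W v = N U v ∧ W v

    nbr-intro : ∀ U W {v} → N U v ≡ true → W v ≡ true → nbr U W v ≡ true
    nbr-intro U W p q = trans (cong₂ _∧_ p q) refl

    nbr-∅ : ∀ W → count (nbr ∅ W) ≡ 0
    nbr-∅ W = sum-zero λ v → cong ι (¬-not λ e → empty (N-elim ∅ (∧-conicalˡ (N ∅ v) _ e)))
      where
      empty : ∀ {v} → ¬ (∃[ u ] (lookup ∅ u ≡ true × adj u v ≡ true))
      empty (u , p , _) = contradiction (trans (sym (lookup∘tabulate _ u)) p) λ ()

    nbr-submodular : ∀ U V W →
      count (nbr (U ∪ V) W) + count (nbr (U ∩ V) W) ≤ count (nbr U W) + count (nbr V W)
    nbr-submodular U V W = begin
      count (nbr (U ∪ V) W) + count (nbr (U ∩ V) W) ≡⟨ ∑-distrib-+ {n} _ _ ⟨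
      sum (λ v → ι (nbr (U ∪ V) W v) + ι (nbr (U ∩ V) W v))
        ≤⟨ sum-mono (λ v → ι-submodular (un v) (inl v) (inr v)) ⟩
      sum (λ v → ι (nbr U W v) + ι (nbr V W v)) ≡⟨ ∑-distrib-+ {n} _ _ ⟩
      count (nbr U W) + count (nbr V W) ∎
      where
      open ≤-Reasoning
      un : ∀ v → nbr (U ∪ V) W v ≡ true → nbr U W v ≡ false → nbr V W v ≡ true
      un v e f with ∧-conicalʳ (N (U ∪ V) v) _ e
      ... | w = nbr-intro V W (N-∪ U V (∧-conicalˡ _ _ e) (¬-not λ t → contradiction (trans (sym (nbr-intro U W t w)) f) λ ())) w
      inl : ∀ v → nbr (U ∩ V) W v ≡ true → nbr U W v ≡ true
      inl v e = nbr-intro U W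
        (N-mono (U ∩ V) U (λ u p → ∧-conicalˡ _ _ (trans (sym (∩≡ U V u)) p)) (∧-conicalˡ _ _ e)) (∧-conicalʳ (N (U ∩ V) v) _ e)
      inr : ∀ v → nbr (U ∩ V) W v ≡ true → nbr V W v ≡ true
      inr v e = nbr-intro V W
        (N-mono (U ∩ V) V (λ u p → ∧-conicalʳ (lookup U u) _ (trans (sym (∩≡ U V u)) p)) (∧-conicalˡ _ _ e)) (∧-conicalʳ (N (U ∩ V) v) _ e)

    away : Subset n → Fin n → Bool
    away U v = not (lookup U v) ∧ not (N U v)

    -- One-sided form of "any two disjoint sets of m vertices are joined": the second set would
    -- consist of the vertices away from `U`.
    Joined : ℕ → Set
    Joined m = ∀ U → m ≤ size U → count (away U) < m

    cover : ∀ U W → count W ≤ size U + count (nbr U W) + count (away U)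
    cover U W = ≤-trans
      (sum-mono (λ v → lem (W v) (lookup U v) (N U v)))
      (≤-reflexive (trans (∑-distrib-+ {n} _ _) (cong (_+ count (away U)) (∑-distrib-+ {n} _ _))))
      where
      lem : ∀ w u x → ι w ≤ ι u + ι (x ∧ w) + ι (not u ∧ not x)
      lem false u x = z≤n
      lem true true x = s≤s z≤n
      lem true false true = s≤s z≤n
      lem true false false = s≤s z≤n

    module Hall (m : ℕ) where

      -- The cut-off 2m leaves room for the two kinds of sets built below: the union of two tight
      -- sets of at most `m` vertices each, and a tight set together with `s`.
      Violates : (Fin n → Bool) → (Fin n → ℕ) → Subset n → Set
      Violates W r U = size U ≤ m + m × count (nbr U W) < mass r U

      violates? : ∀ W r U → Dec (Violates W r U)
      violates? W r U = (size U ≤? m + m) ×-dec (count (nbr U W) <? mass r U)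

      Hall : (Fin n → Bool) → (Fin n → ℕ) → Set
      Hall W r = ∀ U → size U ≤ m + m → mass r U ≤ count (nbr U W)

      module Extension (1≤m : 1 ≤ m) (joined : Joined m) (D : ℕ)
        (W : Fin n → Bool) (r : Fin n → ℕ) (hall : Hall W r)
        (r≤D : ∀ v → r v ≤ D) (r≥1 : ∀ v → W v ≡ true → 1 ≤ r v)
        (room : D * (m + m) + (m + m) + m ≤ count W)
        (s : Fin n) (s∉W : W s ≡ false) (rs≥1 : 1 ≤ r s) where

        -- Only one inequality is recorded; for sets of at most 2m vertices `hall` supplies the
        -- other.
        Tight : Subset n → Set
        Tight U = count (nbr U W) ≤ mass r U

        -- A tight set with m to 2m vertices has at most D · 2m neighbours in `W`, and fewer than
        -- `m` vertices are away from it. Together with the set itself this is less than `room`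
        -- promises for `W`.
        tight-small : ∀ U → size U ≤ m + m → Tight U → size U ≤ m
        tight-small U small tight with ≤-total (size U) m
        ... | inj₁ le = le
        ... | inj₂ ge = contradiction room (<⇒≱ (begin-strict
          count W                                     ≤⟨ cover U W ⟩
          size U + count (nbr U W) + count (away U)   <⟨ +-monoʳ-< (size U + count (nbr U W)) (joined U ge) ⟩
          size U + count (nbr U W) + m                ≤⟨ +-monoˡ-≤ m (+-mono-≤ small tight) ⟩
          (m + m) + mass r U + m
            ≤⟨ +-monoˡ-≤ m (+-monoʳ-≤ (m + m) (≤-trans (mass-bound r D r≤D U) (*-monoʳ-≤ D small))) ⟩
          (m + m) + D * (m + m) + m                   ≡⟨ cong (_+ m) (+-comm (m + m) _) ⟩
          D * (m + m) + (m + m) + m                   ∎))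
          where open ≤-Reasoning

        -- Neighbour counts are submodular and demand is modular. `hall` on the intersection bounds
        -- its demand by its neighbours, and that demand cancels.
        tight-∪ : ∀ U V → size U ≤ m → size V ≤ m → Tight U → Tight V → Tight (U ∪ V)
        tight-∪ U V sU sV tU tV = +-cancelʳ-≤ (mass r (U ∩ V)) _ _ (begin
          count (nbr (U ∪ V) W) + mass r (U ∩ V)
            ≤⟨ +-monoʳ-≤ (count (nbr (U ∪ V) W)) (hall (U ∩ V) sI) ⟩
          count (nbr (U ∪ V) W) + count (nbr (U ∩ V) W) ≤⟨ nbr-submodular U V W ⟩
          count (nbr U W) + count (nbr V W)             ≤⟨ +-mono-≤ tU tV ⟩
          mass r U + mass r V                           ≡⟨ mass-modular r U V ⟨
          mass r (U ∪ V) + mass r (U ∩ V)               ∎)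
          where
          open ≤-Reasoning
          sI : size (U ∩ V) ≤ m + m
          sI = ≤-trans (sum-mono λ v → ι-mono λ e → ∧-conicalˡ _ _ (trans (sym (∩≡ U V v)) e)) (≤-trans sU (m≤m+n m m))

        W′ : Fin n → Fin n → Bool
        W′ y v = W v ∧ not (v is y)

        -- The vertex `y` enters with one unit already spent: its edge to the parent `s` counts
        -- towards its degree.
        r′ : Fin n → Fin n → ℕ
        r′ y v = r v ∸ ι (v is s) ∸ ι (v is y)

        -- Giving y to s lowers |N(U) ∩ W| by [y ∈ N(U)] and r(U) by [s ∈ U] + [y ∈ U], so a
        -- set that becomes violated was tight, sees y and avoids s.
        module _ (y : Fin n) (y∈W : W y ≡ true) (U : Subset n) (bad : Violates (W′ y) (r′ y) U) where

          private
            s≢y : s ≢ y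
            s≢y refl = contradiction (trans (sym y∈W) s∉W) λ ()

            pt : ∀ b v → (if b then r v else 0) ≡ (if b then r′ y v else 0) + (if b then ι (v is s) + ι (v is y) else 0)
            pt false v = refl
            pt true v = sym (trans (cong (_+ (ι (v is s) + ι (v is y))) (∸-+-assoc (r v) (ι (v is s)) (ι (v is y))))
                (m∸n+n≡m (low v)))
              where
              -- The truncated subtractions in `r′` never truncate: `s` has demand left, so has `y`
              -- as a vertex of `W`, and the two are different.
              low : ∀ v → ι (v is s) + ι (v is y) ≤ r v
              low v with v Fin.≟ s | v Fin.≟ y
              ... | yes refl | yes p = contradiction p s≢y
              ... | yes refl | no _ = rs≥1
              ... | no _ | yes refl = r≥1 _ y∈W
              ... | no _ | no _ = z≤n

            extra : Fin n → ℕ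
            extra v = if lookup U v then ι (v is s) + ι (v is y) else 0

            mass-split : mass r U ≡ mass (r′ y) U + sum extra
            mass-split = trans (sum-cong-≗ (λ v → pt (lookup U v) v)) (∑-distrib-+ {n} _ _)

            nbr-split : count (nbr U W) ≤ count (nbr U (W′ y)) + ι (N U y)
            nbr-split = subst (λ x → count (nbr U W) ≤ count (nbr U (W′ y)) + x)
              (trans (sum-point (λ v → ι (N U v ∧ (v is y))) y λ j j≢y → cong ι (trans (cong (N U j ∧_) (is-no j≢y)) (∧-zeroʳ _)))
                     (cong ι (trans (cong (N U y ∧_) (is-refl y)) (∧-identityʳ _))))
              (sum-mono₁₂ λ v → lem (N U v) (W v) (v is y))
              where
              lem : ∀ a w b → ι (a ∧ w) ≤ ι (a ∧ (w ∧ not b)) + ι (a ∧ b)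
              lem false w b = z≤n
              lem true false b = z≤n
              lem true true false = ≤-refl
              lem true true true = ≤-refl

            squeeze : mass (r′ y) U + sum extra < mass (r′ y) U + ι (N U y)
            squeeze = begin-strict
              mass (r′ y) U + sum extra           ≡⟨ mass-split ⟨
              mass r U                            ≤⟨ hall U (proj₁ bad) ⟩
              count (nbr U W)                     ≤⟨ nbr-split ⟩
              count (nbr U (W′ y)) + ι (N U y)    <⟨ +-monoˡ-< (ι (N U y)) (proj₂ bad) ⟩
              mass (r′ y) U + ι (N U y)           ∎
              where open ≤-Reasoning

            -- A sum below an indicator is 0, and the indicator is 1. The two halves give
            -- `bad-avoids` and `bad-sees`.
            extra<ι : sum extra < ι (N U y)
            extra<ι = +-cancelˡ-< (mass (r′ y) U) _ _ squeeze

          bad-tight : Tight U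
          bad-tight = begin
            count (nbr U W)                   ≤⟨ nbr-split ⟩
            count (nbr U (W′ y)) + ι (N U y)  ≤⟨ +-monoʳ-≤ _ (ι≤1 (N U y)) ⟩
            count (nbr U (W′ y)) + 1          ≡⟨ +-comm _ 1 ⟩
            suc (count (nbr U (W′ y)))        ≤⟨ proj₂ bad ⟩
            mass (r′ y) U                     ≤⟨ m≤m+n _ _ ⟩
            mass (r′ y) U + sum extra         ≡⟨ mass-split ⟨
            mass r U                          ∎
            where open ≤-Reasoning

          bad-sees : N U y ≡ true
          bad-sees = ι-positive (≤-trans (s≤s z≤n) extra<ι)

          bad-avoids : lookup U s ≡ false
          bad-avoids = ¬-not λ s∈U → contradiction (≤-trans extra<ι (ι≤1 _)) (<⇒≱ (s≤s (≤-trans (one s∈U) (≤sum extra s))))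
            where
            one : lookup U s ≡ true → 1 ≤ extra s
            one e rewrite e | is-refl s = s≤s z≤n

        extend : ∃[ y ] (W y ≡ true × adj s y ≡ true × Hall (W′ y) (r′ y))
        extend with any? (λ y → (W y Bool.≟ true) ×-dec ((adj s y Bool.≟ true) ×-dec ¬? (anySubset? (violates? (W′ y) (r′ y)))))
        ... | yes (y , y∈W , sy , ¬bad) = y , y∈W , sy , λ U small → ≮⇒≥ λ lt → ¬bad (U , small , lt)
        ... | no none = contradiction (hall U⁺ U⁺-small) (<⇒≱ (begin-strict
          count (nbr U⁺ W)            ≤⟨ sum-mono (λ v → ι-mono (absorb v)) ⟩
          count (nbr U W)             ≤⟨ U-tight ⟩
          mass r U                    <⟨ m<m+n (mass r U) rs≥1 ⟩
          mass r U + r s              ≡⟨ mass-⁺ ⟨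
          mass r U⁺                   ∎))
          where
          open ≤-Reasoning
          culprit : ∀ y → W y ≡ true → adj s y ≡ true → ∃ (Violates (W′ y) (r′ y))
          culprit y y∈W sy with anySubset? (violates? (W′ y) (r′ y))
          ... | yes b = b
          ... | no ¬b = contradiction (y , y∈W , sy , ¬b) none
          Covers : List (Fin n) → Subset n → Set
          Covers ys U = size U ≤ m × Tight U × lookup U s ≡ false ×
                        (∀ y → y ∈ ys → W y ≡ true → adj s y ≡ true → N U y ≡ true)
          collect : ∀ ys → ∃ (Covers ys)
          collect [] = ∅ , ≤-trans (≤-reflexive (size-∅ {n})) z≤n , empty-tight , lookup∘tabulate _ s , λ _ ()
            where
            empty-tight : Tight ∅
            empty-tight = ≤-trans (≤-reflexive (nbr-∅ W)) z≤n
          collect (y ∷ ys) with collect ys | W y in eqW | adj s y in eqA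
          ... | U , a , b , c , f | false | _ = U , a , b , c , λ { z (here refl) p _ → contradiction (trans (sym p) eqW) λ () ; z (there q) → f z q }
          ... | U , a , b , c , f | true | false = U , a , b , c , λ { z (here refl) _ p → contradiction (trans (sym p) eqA) λ () ; z (there q) → f z q }
          ... | U , a , b , c , f | true | true with culprit y eqW eqA
          -- The union has at most 2m vertices and is tight, so it has at most `m` again. This reset
          -- is what allows arbitrarily many sets to be joined.
          ...   | V , bad = U ∪ V , tight-small (U ∪ V) (≤-trans (size-∪ U V) (+-mono-≤ a V≤m)) U∪V-tight
                          , U∪V-tight , trans (∪≡ U V s) (cong₂ _∨_ c (bad-avoids y eqW V bad))
                          , λ { z (here refl) _ _ → N-mono V (U ∪ V) (λ u p → trans (∪≡ U V u) (trans (cong (lookup U u ∨_) p) (∨-zeroʳ _))) (bad-sees y eqW V bad)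
                              ; z (there q) p₁ p₂ → N-mono U (U ∪ V) (λ u p → trans (∪≡ U V u) (cong (_∨ lookup V u) p)) (f z q p₁ p₂) }
            where
            V≤m = tight-small V (proj₁ bad) (bad-tight y eqW V bad)
            U∪V-tight = tight-∪ U V a V≤m b (bad-tight y eqW V bad)
          U = proj₁ (collect (allFin n))
          U-tight = proj₁ (proj₂ (proj₂ (collect (allFin n))))
          s∉U = proj₁ (proj₂ (proj₂ (proj₂ (collect (allFin n)))))
          sees = proj₂ (proj₂ (proj₂ (proj₂ (collect (allFin n)))))
          U⁺ = U ∪ ⁅ s ⁆
          U⁺-small : size U⁺ ≤ m + m
          U⁺-small = ≤-trans (size-∪ U ⁅ s ⁆) (+-mono-≤ (proj₁ (proj₂ (collect (allFin n))))
              (≤-trans (≤-reflexive (size-⁅⁆ s)) 1≤m))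
          absorb : ∀ v → nbr U⁺ W v ≡ true → nbr U W v ≡ true
          absorb v e = nbr-intro U W (byU (N U v) refl) w
            where
            w = ∧-conicalʳ (N U⁺ v) _ e
            byU : ∀ b → N U v ≡ b → N U v ≡ true
            byU true  p = p
            byU false p with N-elim ⁅ s ⁆ (N-∪ U ⁅ s ⁆ (∧-conicalˡ _ _ e) p)
            ... | u , q , uv with is-yes {u = u} (trans (sym (lookup∘tabulate _ u)) q)
            ...   | refl = sees v (∈-allFin v) w uv
          mass-⁺ : mass r U⁺ ≡ mass r U + r s
          mass-⁺ = trans (sum-cong-≗ pt) (trans (∑-distrib-+ {n} _ _) (cong (mass r U +_)
            (trans (sum-point _ s λ j j≢s → cong (if_then r j else 0) (is-no j≢s)) (cong (if_then r s else 0) (is-refl s)))))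
            where
            pt : ∀ v → (if lookup U⁺ v then r v else 0) ≡ (if lookup U v then r v else 0) + (if v is s then r v else 0)
            pt v rewrite ∪≡ U ⁅ s ⁆ v | lookup∘tabulate (_is s) v with v Fin.≟ s
            ... | yes refl rewrite s∉U = refl
            ... | no _ with lookup U v
            ...   | true = sym (+-identityʳ _)
            ...   | false = refl

      -- Vertices of B are given demand 0 instead of being deleted, so that the
      -- Hall condition keeps ranging over all subsets.
      demand : ℕ → Subset n → Fin n → ℕ
      demand c B v = if lookup B v then 0 else c

      mass-demand : ∀ c B U → mass (demand c B) U ≡ c * count (λ v → lookup U v ∧ not (lookup B v))
      mass-demand c B U = trans (sum-cong-≗ λ v → lem (lookup U v) (lookup B v)) (sym (*-distribˡ-sum {n} c _))
        where
        lem : ∀ u b → (if u then (if b then 0 else c) else 0) ≡ c * ι (u ∧ not b)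
        lem false b = sym (*-zeroʳ c)
        lem true false = sym (*-identityʳ c)
        lem true true = sym (*-zeroʳ c)

      -- A set `B` with at most c|B| outside neighbours is enlarged by violating sets for as long as
      -- there are any. It never exceeds 3m vertices, `m` before the step plus 2m for the violating
      -- set, and between m and 3m joinedness would leave fewer than `n` vertices in all, by `room`.
      -- So the size falls back to at most `m` after each step, and as it grows each time, `m` units
      -- of fuel suffice.
      prune : Joined m → (c : ℕ) → (c + 1) * (m + m + m) + m ≤ n →
        ∃[ B ] (size B ≤ m × Hall (not ∘ lookup B) (demand c B))
      prune joined c room = go m ∅ (≤-trans (≤-reflexive (size-∅ {n})) z≤n)
          (≤-trans (≤-reflexive (nbr-∅ (not ∘ lookup ∅))) z≤n) (m≤n+m m _)
        where
        open ≤-Reasoning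
        Small : Subset n → Set
        Small B = size B ≤ m
        Closed : Subset n → Set
        Closed B = count (nbr B (not ∘ lookup B)) ≤ c * size B
        closed-small : ∀ B → size B ≤ m + m + m → Closed B → Small B
        closed-small B B≤3m closed with ≤-total (size B) m
        ... | inj₁ le = le
        ... | inj₂ ge = contradiction room (<⇒≱ (begin-strict
          n ≡⟨ count-not (lookup B) ⟨
          size B + count (not ∘ lookup B)
            ≤⟨ +-monoʳ-≤ (size B) (sum-mono₁₂ (λ v → lem (lookup B v) (N B v))) ⟩
          size B + (count (nbr B (not ∘ lookup B)) + count (away B)) ≡⟨ +-assoc (size B) _ _ ⟨
          size B + count (nbr B (not ∘ lookup B)) + count (away B) <⟨ +-monoʳ-< _ (joined B ge) ⟩
          size B + count (nbr B (not ∘ lookup B)) + m ≤⟨ +-monoˡ-≤ m (+-monoʳ-≤ (size B) closed) ⟩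
          size B + c * size B + m
            ≡⟨ cong (_+ m) (solve 2 (λ b c → b :+ c :* b := (c :+ con 1) :* b) refl (size B) c) ⟩
          (c + 1) * size B + m ≤⟨ +-monoˡ-≤ m (*-monoʳ-≤ (c + 1) B≤3m) ⟩
          (c + 1) * (m + m + m) + m ∎))
          where
          open +-*-Solver
          lem : ∀ u x → ι (not u) ≤ ι (x ∧ not u) + ι (not u ∧ not x)
          lem true x = z≤n
          lem false true = s≤s z≤n
          lem false false = s≤s z≤n
        -- Adding a violating set to B keeps B non-expanding, hence small by joinedness.
        go : ∀ fuel B → Small B → Closed B → m ≤ size B + fuel → ∃[ B ] (size B ≤ m × Hall (not ∘ lookup B) (demand c B))
        go fuel B small closed enough with anySubset? (violates? (not ∘ lookup B) (demand c B))
        ... | no ¬bad = B , small , λ U sU → ≮⇒≥ λ lt → ¬bad (U , sU , lt)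
        ... | yes (U , sU , lt) = next fuel enough
          where
          B′ = B ∪ U
          split : c * size B′ ≡ c * size B + mass (demand c B) U
          split = trans (*-distribˡ-sum {n} c _) (trans (sum-cong-≗ pt)
              (trans (∑-distrib-+ {n} _ _) (cong (_+ mass (demand c B) U) (sym (*-distribˡ-sum {n} c _)))))
            where
            lem : ∀ b u → c * ι (b ∨ u) ≡ c * ι b + (if u then (if b then 0 else c) else 0)
            lem true true = sym (+-identityʳ _)
            lem true false = sym (+-identityʳ _)
            lem false true rewrite *-zeroʳ c = *-identityʳ c
            lem false false = sym (+-identityʳ _)
            pt : ∀ v → c * ι (lookup B′ v) ≡ c * ι (lookup B v) + (if lookup U v then demand c B v else 0)
            pt v rewrite ∪≡ B U v = lem (lookup B v) (lookup U v)
          -- Violation makes the demand of `U` positive, and vertices of `B` demand nothing, so `U`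
          -- has a vertex outside `B`.
          bigger : size B < size B′
          bigger = *-cancelˡ-< c _ _ (subst (c * size B <_) (sym split) (m<m+n _ (≤-trans (s≤s z≤n) lt)))
          closed′ : Closed B′
          closed′ = begin
            count (nbr B′ (not ∘ lookup B′)) ≤⟨ sum-mono₁₂ (λ v → ι-cover (spread v)) ⟩
            count (nbr B (not ∘ lookup B)) + count (nbr U (not ∘ lookup B)) ≤⟨ +-mono-≤ closed (<⇒≤ lt) ⟩
            c * size B + mass (demand c B) U ≡⟨ split ⟨
            c * size B′ ∎
            where
            nor : ∀ a b → not (a ∨ b) ≡ true → not a ≡ true
            nor false b _ = refl
            outB : ∀ v → not (lookup B′ v) ≡ true → not (lookup B v) ≡ true
            outB v e rewrite ∪≡ B U v = nor (lookup B v) _ e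
            spread : ∀ v → nbr B′ (not ∘ lookup B′) v ≡ true → nbr B (not ∘ lookup B) v ≡ false →
                     nbr U (not ∘ lookup B) v ≡ true
            spread v e f = nbr-intro U (not ∘ lookup B) (N-∪ B U (∧-conicalˡ _ _ e) unseen) v∉B
              where
              v∉B = outB v (∧-conicalʳ (N B′ v) _ e)
              unseen : N B v ≡ false
              unseen = ¬-not λ t → contradiction (trans (sym (nbr-intro B (not ∘ lookup B) t v∉B)) f) λ ()
          small′ : Small B′
          small′ = closed-small B′ (≤-trans (size-∪ B U) (≤-trans (+-mono-≤ small sU)
              (≤-reflexive (sym (+-assoc m m m))))) closed′
          next : ∀ fuel → m ≤ size B + fuel → ∃[ B ] (size B ≤ m × Hall (not ∘ lookup B) (demand c B))
          next zero en = contradiction (≤-trans bigger small′) (<⇒≱ (s≤s (subst (m ≤_) (+-identityʳ _) en)))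
          next (suc fuel) en = go fuel B′ small′ closed′ (≤-trans en
              (≤-trans (≤-reflexive (+-suc _ fuel)) (+-monoˡ-≤ fuel bigger)))

-- Growing a tree leaf by leaf, and following its growth in a joined graph

module TreeEmbedding where

  open import Defs
  open import Data.Bool using (Bool; true; false; _∧_; not; if_then_else_)
  import Data.Bool as Bool
  open import Data.Bool.Properties using (∧-conicalˡ; ∧-conicalʳ; ∧-zeroʳ; not-involutive)
  open import Data.Fin using (Fin; zero; suc; inject₁; fromℕ)
  import Data.Fin as Fin
  open import Data.Fin.Properties using (any?; opposite-involutive)
  open import Data.List using (List; []; _∷_; length; filterᵇ; allFin; _++_)
  open import Data.List.Properties using (length-++; length-tabulate)
  open import Data.List.Membership.Propositional using (_∈_; _∉_)
  open import Data.List.Membership.Propositional.Properties using (∈-allFin; ∈-∃++; ∈-++⁻; ∈-++⁺ˡ; ∈-++⁺ʳ)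
  import Data.List.Membership.DecPropositional as DecMembership
  open import Data.List.Relation.Unary.All as All using (All; []; _∷_)
  open import Data.List.Relation.Unary.AllPairs using ([]; _∷_)
  open import Data.List.Relation.Unary.Any using (here; there)
  open import Data.List.Relation.Unary.Unique.Propositional using (Unique)
  open import Data.Nat using (ℕ; zero; suc; _+_; _*_; _∸_; _≤_; _<_; z≤n; s≤s)
  open import Data.Nat.Properties
  open import Data.Nat.Solver using (module +-*-Solver)
  open import Data.Product using (_×_; _,_; ∃-syntax; proj₁; proj₂)
  open import Data.Sum using (_⊎_; inj₁; inj₂)
  open import Data.Vec using (lookup)
  import Data.Vec.Functional as Vector
  open import Function using (_∘_; id)
  open import Function.Definitions using (Injective)
  open import Relation.Binary.PropositionalEquality hiding (sym)
  import Relation.Binary.PropositionalEquality as ≡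
  open import Relation.Nullary using (yes; no; contradiction)
  open import Relation.Nullary.Decidable using (_×-dec_; ¬?)

  open Embedding

  private variable
    k n : ℕ
    A : Set

  unique-⊆-length : {xs ys : List A} → Unique xs → (∀ {x} → x ∈ xs → x ∈ ys) → length xs ≤ length ys
  unique-⊆-length [] sub = z≤n
  unique-⊆-length {xs = x ∷ xs} (x≢ ∷ uniq) sub with ∈-∃++ (sub (here refl))
  ... | as , bs , refl = ≤-trans (s≤s (unique-⊆-length {ys = as ++ bs} uniq drop)) (≤-reflexive (≡.sym shift))
    where
    shift : length (as ++ x ∷ bs) ≡ suc (length (as ++ bs))
    shift = trans (length-++ as) (trans (+-suc (length as) _) (cong suc (≡.sym (length-++ as))))
    drop : ∀ {z} → z ∈ xs → z ∈ as ++ bs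
    drop z∈xs with ∈-++⁻ as (sub (there z∈xs))
    ... | inj₁ p = ∈-++⁺ˡ p
    ... | inj₂ (here refl) = contradiction refl (All.lookup x≢ z∈xs)
    ... | inj₂ (there p) = ∈-++⁺ʳ as p

  filterᵇ-⊆ : (f : A → Bool) (xs : List A) → ∀ {x} → x ∈ filterᵇ f xs → x ∈ xs × f x ≡ true
  filterᵇ-⊆ f (y ∷ ys) p with f y in eq
  filterᵇ-⊆ f (y ∷ ys) (here refl) | true = here refl , eq
  filterᵇ-⊆ f (y ∷ ys) (there p) | true with filterᵇ-⊆ f ys p
  ... | q , e = there q , e
  filterᵇ-⊆ f (y ∷ ys) p | false with filterᵇ-⊆ f ys p
  ... | q , e = there q , e

  ∈-filterᵇ : (f : A → Bool) (xs : List A) → ∀ {x} → x ∈ xs → f x ≡ true → x ∈ filterᵇ f xs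
  ∈-filterᵇ f (y ∷ ys) p e with f y in eq
  ∈-filterᵇ f (y ∷ ys) (here refl) e | true = here refl
  ∈-filterᵇ f (y ∷ ys) (there p) e | true = there (∈-filterᵇ f ys p e)
  ∈-filterᵇ f (y ∷ ys) (here refl) e | false = contradiction (trans (≡.sym e) eq) λ ()
  ∈-filterᵇ f (y ∷ ys) (there p) e | false = ∈-filterᵇ f ys p e

  filterᵇ-unique : (f : A → Bool) {xs : List A} → Unique xs → Unique (filterᵇ f xs)
  filterᵇ-unique f {[]} [] = []
  filterᵇ-unique f {x ∷ xs} (p ∷ u) with f x
  ... | true  = All.tabulate (λ q → All.lookup p (proj₁ (filterᵇ-⊆ f xs q))) ∷ filterᵇ-unique f u
  ... | false = filterᵇ-unique f u

  opposite-inject₁ : ∀ {l} (i : Fin l) → Fin.opposite (inject₁ i) ≡ suc (Fin.opposite i)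
  opposite-inject₁ zero    = refl
  opposite-inject₁ (suc i) = cong inject₁ (opposite-inject₁ i)

  opposite-fromℕ : ∀ l → Fin.opposite (fromℕ l) ≡ zero
  opposite-fromℕ zero    = refl
  opposite-fromℕ (suc l) = cong inject₁ (opposite-fromℕ l)

  opposite-injective : ∀ {l} → Injective _≡_ _≡_ (Fin.opposite {l})
  opposite-injective {x = i} {j} e =
    trans (≡.sym (opposite-involutive i)) (trans (cong Fin.opposite e) (opposite-involutive j))

  not-true : ∀ {b} → not b ≡ true → b ≡ false
  not-true {b} e = trans (≡.sym (not-involutive b)) (cong not e)

  -- A certificate that `S`, newest vertex first, was built by adding leaves. The last premise of
  -- `grow` is where acyclicity is stored; it makes `es` contain every edge of `T` inside `S`, up to
  -- orientation.
  data Grown (T : Graph k) : List (Fin k) → List (Fin k × Fin k) → Set where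
    root : ∀ v → Grown T (v ∷ []) []
    grow : ∀ {S es u v} → Grown T S es → v ∉ S → u ∈ S → Adj T u v →
           (∀ w → w ∈ S → Adj T w v → w ≡ u) → Grown T (v ∷ S) ((u , v) ∷ es)

  module _ {T : Graph k} where

    grown-unique : ∀ {S es} → Grown T S es → Unique S
    grown-unique (root v) = [] ∷ []
    grown-unique (grow g v∉S _ _ _) = All.tabulate (λ { q refl → v∉S q }) ∷ grown-unique g

    grown-length : ∀ {S es} → Grown T S es → length S ≤ k
    grown-length {S} g = subst (length S ≤_) (length-tabulate {n = k} id)
      (unique-⊆-length (grown-unique g) (λ _ → ∈-allFin _))

    grown-edges : ∀ {S es} → Grown T S es → length es ≤ length S
    grown-edges (root v) = z≤n
    grown-edges (grow g _ _ _ _) = s≤s (grown-edges g)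

    grown-complete : ∀ {S es} → Grown T S es → ∀ {u v} → u ∈ S → v ∈ S → Adj T u v → (u , v) ∈ es ⊎ (v , u) ∈ es
    grown-complete (root w) (here refl) (here refl) a = contradiction (trans (≡.sym a) (irrefl T w)) λ ()
    grown-complete (grow {v = w} g _ _ _ _) (here refl) (here refl) a = contradiction (trans (≡.sym a) (irrefl T w)) λ ()
    grown-complete (grow g _ _ _ uniq) (here refl) (there q) a with uniq _ q (trans (sym T _ _) a)
    ... | refl = inj₂ (here refl)
    grown-complete (grow g _ _ _ uniq) (there p) (here refl) a with uniq _ p a
    ... | refl = inj₁ (here refl)
    grown-complete (grow g _ _ _ _) (there p) (there q) a with grown-complete g p q a
    ... | inj₁ e = inj₁ (there e)
    ... | inj₂ e = inj₂ (there e)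

    -- Paths are injective functions because `Cycle` asks for one; `inside` ensures that a vertex
    -- outside `S` can be put in front without repetition.
    record Path (S : List (Fin k)) (a b : Fin k) : Set where
      field
        len    : ℕ
        vert   : Fin (suc len) → Fin k
        inj    : Injective _≡_ _≡_ vert
        start  : vert zero ≡ a
        end    : vert (fromℕ len) ≡ b
        consec : ∀ i → Adj T (vert (inject₁ i)) (vert (suc i))
        inside : ∀ i → vert i ∈ S

    cons-injective : ∀ {l S v} (f : Fin l → Fin k) → Injective _≡_ _≡_ f → (∀ i → f i ∈ S) → v ∉ S →
                     Injective _≡_ _≡_ (v Vector.∷ f)
    cons-injective f inj ins v∉S {zero} {zero} e = refl
    cons-injective f inj ins v∉S {zero} {suc j} refl = contradiction (ins j) v∉S
    cons-injective f inj ins v∉S {suc i} {zero} refl = contradiction (ins i) v∉S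
    cons-injective f inj ins v∉S {suc i} {suc j} e = cong suc (inj e)

    trivial-path : ∀ {S v} → v ∈ S → Path S v v
    trivial-path {v = v} v∈S = record
      { len = 0 ; vert = λ _ → v ; inj = λ { {zero} {zero} _ → refl } ; start = refl ; end = refl
      ; consec = λ () ; inside = λ _ → v∈S }

    weaken-path : ∀ {S a b v} → Path S a b → Path (v ∷ S) a b
    weaken-path P = record { Path P ; inside = there ∘ Path.inside P }

    extend-path : ∀ {S a b v} → v ∉ S → Adj T v a → Path S a b → Path (v ∷ S) v b
    extend-path {v = v} v∉S va P = record
      { len = suc len ; vert = v Vector.∷ vert ; inj = cons-injective vert inj inside v∉S ; start = refl ; end = end
      ; consec = λ { zero → subst (Adj T v) (≡.sym start) va ; (suc i) → consec i }
      ; inside = λ { zero → here refl ; (suc i) → there (inside i) } }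
      where open Path P

    reverse-path : ∀ {S a b} → Path S a b → Path S b a
    reverse-path P = record
      { len = len ; vert = vert ∘ Fin.opposite ; inj = opposite-injective ∘ inj
      ; start = end ; end = trans (cong vert (opposite-fromℕ len)) start
      ; consec = λ i → trans (cong (λ j → adj T (vert j) (vert (inject₁ (Fin.opposite i)))) (opposite-inject₁ i))
                         (trans (sym T _ _) (consec (Fin.opposite i)))
      ; inside = inside ∘ Fin.opposite }
      where open Path P

    grown-path : ∀ {S es} → Grown T S es → ∀ {a b} → a ∈ S → b ∈ S → Path S a b
    grown-path (root v) (here refl) (here refl) = trivial-path (here refl)
    grown-path (grow g v∉S u∈S uv _) (here refl) (here refl) = trivial-path (here refl)
    grown-path (grow g v∉S u∈S uv _) (here refl) (there q) =
      extend-path v∉S (trans (sym T _ _) uv) (grown-path g u∈S q)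
    grown-path (grow g v∉S u∈S uv _) (there p) (here refl) =
      reverse-path (extend-path v∉S (trans (sym T _ _) uv) (grown-path g u∈S p))
    grown-path (grow g v∉S u∈S uv _) (there p) (there q) = weaken-path (grown-path g p q)

    -- The cycle is `v` followed by the path. As `a` and `b` differ, the path has at least two
    -- vertices, which gives the three that `Cycle` requires.
    close-cycle : ∀ {S a b v} → v ∉ S → Path S a b → a ≢ b → Adj T v a → Adj T b v → Cycle T
    close-cycle {v = v} v∉S record { len = zero ; start = s ; end = e } a≢b va bv = contradiction (trans (≡.sym s) e) a≢b
    close-cycle {v = v} v∉S P@record { len = suc l ; end = e } a≢b va bv = record
      { len = l ; vert = vert′ ; inj = inj ; consec = consec ; close = subst (λ x → Adj T x v) (≡.sym e) bv }
      where open Path (extend-path v∉S va P) renaming (vert to vert′)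

    -- If no edge leaves `S`, connectedness puts every vertex in `S`. If an edge leaves `S` towards
    -- `v`, its end in `S` is unique, since two ends and the path between them would close a cycle
    -- through `v`. Fuel `k` suffices because `S` has no repetitions.
    grow-all : IsTree T → Fin k → ∃[ S ] ∃[ es ] (Grown T S es × ∀ v → v ∈ S)
    grow-all (connected , acyclic) r = go k (root r) (here refl) (m≤m+n k 1)
      where
      open DecMembership Fin._≟_ using (_∈?_)
      go : ∀ fuel {S es} → Grown T S es → r ∈ S → k ≤ fuel + length S → ∃[ S ] ∃[ es ] (Grown T S es × ∀ v → v ∈ S)
      go fuel {S} {es} g r∈S enough
        with any? (λ v → any? (λ u → ¬? (v ∈? S) ×-dec ((u ∈? S) ×-dec (adj T u v Bool.≟ true))))
      ... | no none = S , es , g , λ v → reach (connected r v) r∈S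
        where
        reach : ∀ {u v} → Walk T u v → u ∈ S → v ∈ S
        reach here u∈S = u∈S
        reach (step {v = w} uw walk) u∈S with w ∈? S
        ... | yes w∈S = reach walk w∈S
        ... | no w∉S = contradiction (w , _ , w∉S , u∈S , uw) none
      ... | yes (v , u , v∉S , u∈S , uv) = next fuel enough
        where
        g′ = grow g v∉S u∈S uv λ w w∈S wv → only w w∈S wv
          where
          only : ∀ w → w ∈ S → Adj T w v → w ≡ u
          only w w∈S wv with w Fin.≟ u
          ... | yes p = p
          ... | no w≢u = contradiction (close-cycle v∉S (grown-path g w∈S u∈S) w≢u (trans (sym T _ _) wv) uv) acyclic
        next : ∀ fuel → k ≤ fuel + length S → ∃[ S ] ∃[ es ] (Grown T S es × ∀ v → v ∈ S)
        next zero en = contradiction (grown-length g′) (<⇒≱ (s≤s en))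
        next (suc fuel) en = go fuel g′ (there r∈S) (≤-trans en (≤-reflexive (≡.sym (+-suc fuel _))))

  -- The invariant of the embedding: its start at the root and its preservation at a leaf

  module _ (T : Graph k) (D : ℕ) (bounded : MaxDegreeAtMost T D)
           (adjG : Fin n → Fin n → Bool) (m : ℕ) (1≤m : 1 ≤ m) where

    open Neighbourhood adjG
    open Hall m

    -- Values of `φ` outside `S` are meaningless. `slack` says that the demand left at an image
    -- covers the neighbours still to be placed, as degrees are at most `D`. `room` says that at
    -- most `m` vertices were pruned and the others lost from `W` are the |S| images.
    record Embedded (S : List (Fin k)) (es : List (Fin k × Fin k)) : Set where
      field
        φ     : Fin k → Fin n
        W     : Fin n → Bool
        r     : Fin n → ℕ
        hall  : Hall W r
        r≤D   : ∀ v → r v ≤ D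
        fresh : ∀ v → W v ≡ true → r v ≡ D
        used  : ∀ u → u ∈ S → W (φ u) ≡ false
        inj   : ∀ u v → u ∈ S → v ∈ S → φ u ≡ φ v → u ≡ v
        slack : ∀ u → u ∈ S → D ≤ r (φ u) + length (filterᵇ (adj T u) S)
        edges : ∀ {u v} → (u , v) ∈ es → adjG (φ u) (φ v) ≡ true
        room  : n ≤ m + (length S + count W)

    -- Pruning at `D + 1` instead of `D` pays for the root: its image leaves `W` and costs a set at
    -- most one neighbour, while a set with any demand at all has a surplus of at least one. Sets
    -- without demand satisfy the condition trivially.
    embed-root : Joined m → (D + 1 + 1) * (m + m + m) + m ≤ n → 1 + m ≤ n → ∀ v → Embedded (v ∷ []) []
    embed-root joined big m<n v with prune joined (D + 1) big
    ... | B , B≤m , hall′ with sum-positive (λ x → ι (not (lookup B x))) nonempty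
      where
      nonempty : 0 < count (not ∘ lookup B)
      nonempty = +-cancelˡ-≤ (size B) _ _ (≤-trans (≤-trans (+-monoˡ-≤ 1 B≤m) (≤-trans (≤-reflexive (+-comm m 1)) m<n))
                   (≤-reflexive (≡.sym (count-not (lookup B)))))
    ...   | x , x∉B = record
      { φ = λ _ → x
      ; W = W
      ; r = demand D B
      ; hall = hall
      ; r≤D = λ y → r≤D (lookup B y)
      ; fresh = λ y e → fresh (lookup B y) _ e
      ; used = λ { u (here refl) → trans (cong (λ b → not (lookup B x) ∧ not b) (is-refl x)) (∧-zeroʳ _) }
      ; inj = λ { _ _ (here refl) (here refl) _ → refl }
      ; slack = λ { u (here refl) → ≤-trans (≤-reflexive (≡.sym (cong (if_then 0 else D) (not-true (ι-positive x∉B)))))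
          (m≤m+n _ _) }
      ; edges = λ ()
      ; room = ≤-trans (≤-reflexive (≡.sym (count-not (lookup B)))) (+-mono-≤ B≤m shrink)
      }
      where
      W : Fin n → Bool
      W y = not (lookup B y) ∧ not (y is x)
      r≤D : ∀ b → (if b then 0 else D) ≤ D
      r≤D true = z≤n
      r≤D false = ≤-refl
      fresh : ∀ b c → not b ∧ c ≡ true → (if b then 0 else D) ≡ D
      fresh false c e = refl
      shrink : count (not ∘ lookup B) ≤ 1 + count W
      shrink = ≤-trans (sum-mono₁₂ λ y → ι-remove (not (lookup B y)) (y is x)) (≤-reflexive (cong (_+ count W) (count-is x)))
      hall : Hall W (demand D B)
      hall U small rewrite mass-demand D B U with count (λ y → lookup U y ∧ not (lookup B y)) in eq
      ... | zero = subst (_≤ count (nbr U W)) (≡.sym (*-zeroʳ D)) z≤n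
      ... | suc c = +-cancelˡ-≤ 1 _ _ (begin
        1 + D * suc c ≤⟨ +-monoˡ-≤ _ (s≤s z≤n) ⟩
        suc c + D * suc c ≡⟨ cong (_* suc c) (+-comm 1 D) ⟩
        (D + 1) * suc c ≡⟨ cong ((D + 1) *_) eq ⟨
        (D + 1) * count (λ y → lookup U y ∧ not (lookup B y)) ≡⟨ mass-demand (D + 1) B U ⟨
        mass (demand (D + 1) B) U ≤⟨ hall′ U small ⟩
        count (nbr U (not ∘ lookup B)) ≤⟨ sum-mono₁₂ (λ y → lose (N U y) (not (lookup B y)) (y is x)) ⟩
        count (_is x) + count (nbr U W) ≡⟨ cong (_+ count (nbr U W)) (count-is x) ⟩
        1 + count (nbr U W) ∎)
        where
        open ≤-Reasoning
        lose : ∀ a b c → ι (a ∧ b) ≤ ι c + ι (a ∧ (b ∧ not c))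
        lose false b c = z≤n
        lose true b c = ι-remove b c

    embed-grow : Joined m → k + m + (D * (m + m) + (m + m) + m) ≤ n → 1 ≤ D →
      ∀ {S es u v} → Grown T S es → v ∉ S → u ∈ S → Adj T u v → Embedded S es → Embedded (v ∷ S) ((u , v) ∷ es)
    embed-grow joined big 1≤D {S} {es} {u} {v} g v∉S u∈S uv E = record
      { φ = φ′
      ; W = X.W′ y
      ; r = X.r′ y
      ; hall = proj₂ (proj₂ (proj₂ X.extend))
      ; r≤D = λ w → ≤-trans (≤-trans (m∸n≤m _ (ι (w is y))) (m∸n≤m _ (ι (w is φ u)))) (r≤D w)
      ; fresh = fresh′
      ; used = used′
      ; inj = inj′
      ; slack = slack′
      ; edges = edges′
      ; room = ≤-trans room (+-monoʳ-≤ m (≤-trans (+-monoʳ-≤ (length S) lose) (≤-reflexive (+-suc (length S) _))))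
      }
      where
      open Embedded E
      -- The new leaf is a neighbour of `u` outside `S`, so at most D - 1 neighbours are inside, and
      -- `slack` then leaves demand at the image of `u`.
      degree-room : suc (length (filterᵇ (adj T u) S)) ≤ D
      degree-room = ≤-trans (≤-reflexive (cong length (≡.sym consS)))
          (≤-trans (unique-⊆-length (filterᵇ-unique (adj T u) (All.tabulate (λ { q refl → v∉S q }) ∷ grown-unique g))
          (λ q → ∈-filterᵇ (adj T u) (allFin k) (∈-allFin _) (proj₂ (filterᵇ-⊆ (adj T u) (v ∷ S) q)))) (bounded u))
        where
        consS : filterᵇ (adj T u) (v ∷ S) ≡ v ∷ filterᵇ (adj T u) S
        consS rewrite uv = refl
      1≤r : 1 ≤ r (φ u)
      1≤r = +-cancelʳ-≤ (length (filterᵇ (adj T u) S)) _ _ (≤-trans degree-room (slack u u∈S))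
      roomW : D * (m + m) + (m + m) + m ≤ count W
      roomW = +-cancelˡ-≤ (k + m) _ _ (≤-trans big (≤-trans room
          (≤-trans (+-monoʳ-≤ m (+-monoˡ-≤ (count W) (grown-length g)))
        (≤-reflexive (solve 3 (λ m k c → m :+ (k :+ c) := k :+ m :+ c) refl m k (count W))))))
        where open +-*-Solver
      module X = Extension 1≤m joined D W r hall r≤D (λ w e → ≤-trans 1≤D (≤-reflexive (≡.sym (fresh w e)))) roomW
          (φ u) (used u u∈S) 1≤r
      y = proj₁ X.extend
      y∈W : W y ≡ true
      y∈W = proj₁ (proj₂ X.extend)
      uy : adjG (φ u) y ≡ true
      uy = proj₁ (proj₂ (proj₂ X.extend))
      φ′ : Fin k → Fin n
      φ′ w = if w is v then y else φ w
      φ′-new : φ′ v ≡ y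
      φ′-new rewrite is-refl v = refl
      φ′-old : ∀ {w} → w ∈ S → φ′ w ≡ φ w
      φ′-old {w} w∈S rewrite is-no {u = w} {v} (λ { refl → v∉S w∈S }) = refl
      old≢y : ∀ {w} → w ∈ S → φ w ≢ y
      old≢y {w} w∈S e = contradiction (trans (≡.sym (trans (cong W e) y∈W)) (used w w∈S)) λ ()
      lose : count W ≤ suc (count (X.W′ y))
      lose = ≤-trans (sum-mono₁₂ λ w → ι-remove (W w) (w is y))
        (≤-reflexive (cong (_+ count (X.W′ y)) (count-is y)))
      fresh′ : ∀ w → X.W′ y w ≡ true → X.r′ y w ≡ D
      fresh′ w e = trans (cong₂ (λ a b → r w ∸ ι a ∸ ι b) (is-no w≢φu) (not-true (∧-conicalʳ (W w) _ e)))
          (fresh w (∧-conicalˡ _ _ e))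
        where
        w≢φu : w ≢ φ u
        w≢φu refl = contradiction (trans (≡.sym (∧-conicalˡ _ _ e)) (used u u∈S)) λ ()
      used′ : ∀ w → w ∈ v ∷ S → X.W′ y (φ′ w) ≡ false
      used′ w (here refl) rewrite φ′-new | is-refl y | y∈W = refl
      used′ w (there w∈S) rewrite φ′-old w∈S | used w w∈S = refl
      inj′ : ∀ a b → a ∈ v ∷ S → b ∈ v ∷ S → φ′ a ≡ φ′ b → a ≡ b
      inj′ a b (here refl) (here refl) e = refl
      inj′ a b (here refl) (there q) e = contradiction (trans (≡.sym (φ′-old q)) (trans (≡.sym e) φ′-new)) (old≢y q)
      inj′ a b (there p) (here refl) e = contradiction (trans (≡.sym (φ′-old p)) (trans e φ′-new)) (old≢y p)
      inj′ a b (there p) (there q) e = inj a b p q (trans (≡.sym (φ′-old p)) (trans e (φ′-old q)))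
      slack′ : ∀ w → w ∈ v ∷ S → D ≤ X.r′ y (φ′ w) + length (filterᵇ (adj T w) (v ∷ S))
      -- The new image falls from demand `D` to D - 1, and its parent makes up for the missing unit.
      -- Among the old vertices only `u` loses a unit, and it gains the neighbour `v`.
      slack′ w (here refl) = begin
        D                                                    ≡⟨ fresh y y∈W ⟨
        r y
          ≡⟨ m∸n+n≡m (≤-trans 1≤D (≤-reflexive (≡.sym (fresh y y∈W)))) ⟨
        r y ∸ 1 + 1                                          ≡⟨ cong (_+ 1) r′y ⟨
        X.r′ y (φ′ v) + 1
          ≤⟨ +-monoʳ-≤ _ (unique-⊆-length {xs = u ∷ []} ([] ∷ []) λ { (here refl) → ∈-filterᵇ (adj T v) (v ∷ S)
              (there u∈S) (trans (sym T _ _) uv) }) ⟩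
        X.r′ y (φ′ v) + length (filterᵇ (adj T v) (v ∷ S))   ∎
        where
        open ≤-Reasoning
        r′y : X.r′ y (φ′ v) ≡ r y ∸ 1
        r′y rewrite φ′-new | is-refl y | is-no {u = y} {φ u} (λ e → old≢y u∈S (≡.sym e)) = refl
      slack′ w (there w∈S) rewrite φ′-old w∈S | is-no (old≢y w∈S) with φ w Fin.≟ φ u
      ... | no _ = ≤-trans (slack w w∈S) (+-monoʳ-≤ (r (φ w)) (unique-⊆-length (filterᵇ-unique (adj T w) (grown-unique g))
              (λ q → ∈-filterᵇ (adj T w) (v ∷ S) (there (proj₁ (filterᵇ-⊆ (adj T w) S q))) (proj₂ (filterᵇ-⊆ (adj T w) S q)))))
      ... | yes e with inj w u w∈S u∈S e
      ...   | refl rewrite uv = ≤-trans (slack u u∈S) (≤-reflexive (trans (cong (_+ length (filterᵇ (adj T u) S)) (≡.sym (m∸n+n≡m 1≤r))) (+-assoc (r (φ u) ∸ 1) 1 _)))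
      edges′ : ∀ {a b} → (a , b) ∈ (u , v) ∷ es → adjG (φ′ a) (φ′ b) ≡ true
      edges′ (here refl) = trans (cong₂ adjG (φ′-old u∈S) φ′-new) uy
      edges′ (there p) = trans (cong₂ adjG (φ′-old (proj₁ (ends g p))) (φ′-old (proj₂ (ends g p)))) (edges p)
        where
        ends : ∀ {S es} → Grown T S es → ∀ {a b} → (a , b) ∈ es → a ∈ S × b ∈ S
        ends (grow g _ u∈S _ _) (here refl) = there u∈S , here refl
        ends (grow g _ _ _ _) (there p) = there (proj₁ (ends g p)) , there (proj₂ (ends g p))

    -- The root dictates the constant: pruning at `D + 1` asks for (D + 2) · 3m + m = (3D + 7)m
    -- vertices, while a leaf asks for k + (2D + 4)m.
    embed-grown : Joined m → k + (3 * D + 7) * m ≤ n → 1 ≤ D → ∀ {S es} → Grown T S es → Embedded S es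
    embed-grown joined big 1≤D (root v) = embed-root joined
      (≤-trans (≤-trans (≤-reflexive (solve 2 (λ D m → (D :+ con 1 :+ con 1) :* (m :+ m :+ m) :+ m := (con 3 :* D :+ con 7) :* m) refl D m)) (m≤n+m _ k)) big)
      (≤-trans (+-mono-≤ k≥1 (≤-trans (≤-reflexive (≡.sym (*-identityˡ m))) (*-monoˡ-≤ m (≤-trans (s≤s z≤n) (m≤n+m 7 (3 * D)))))) big) v
      where
      open +-*-Solver
      k≥1 : 1 ≤ k
      k≥1 = nonempty v
        where
        nonempty : ∀ {l} → Fin l → 1 ≤ l
        nonempty zero = s≤s z≤n
        nonempty (suc _) = s≤s z≤n
    embed-grown joined big 1≤D (grow g v∉S u∈S uv _) = embed-grow joined
      (≤-trans (≤-trans (≤-reflexive (solve 3 (λ k D m → k :+ m :+ (D :* (m :+ m) :+ (m :+ m) :+ m) := k :+ (con 2 :* D :+ con 4) :* m) refl k D m))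
        (+-monoʳ-≤ k (*-monoˡ-≤ m (+-mono-≤ (*-monoˡ-≤ D {2} {3} (s≤s (s≤s z≤n))) (s≤s (s≤s (s≤s (s≤s z≤n)))))))) big)
      1≤D g v∉S u∈S uv (embed-grown joined big 1≤D g)
      where open +-*-Solver

-- Rational arithmetic, averages over finite product spaces and the exchange of coordinates

module Exchanging where

  open import Defs
  open import Data.Bool using (Bool; true; false; _∧_; not)
  open import Data.Fin using (Fin; zero; suc)
  import Data.Fin as Fin
  open import Data.Integer using (+_)
  import Data.Integer as ℤ
  import Data.Integer.Properties as ℤ
  open import Data.List as List using (List; []; _∷_; length; filter; allFin; _++_; cartesianProductWith)
  open import Data.List.Membership.Propositional using (_∈_; _∉_; find; lose)
  open import Data.List.Membership.Propositional.Properties using (∈-++⁺ˡ; ∈-++⁺ʳ; ∈-filter⁺; ∈-cartesianProductWith⁺)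
  import Data.List.Membership.DecPropositional as DecMembership
  open import Data.List.Properties using (length-++; length-tabulate)
  open import Data.List.Relation.Unary.All as All using (All; []; _∷_)
  open import Data.List.Relation.Unary.Any as Any using (Any; here; there)
  open import Data.List.Relation.Unary.Unique.Propositional using (Unique)
  import Data.List.Relation.Unary.Unique.Propositional.Properties as Unique
  open import Data.Nat as ℕ using (ℕ; zero; suc; z≤n; s≤s)
  import Data.Nat.Properties as ℕ
  open import Data.Product using (_×_; _,_; ∃-syntax; proj₁; proj₂)
  open import Data.Rational using (ℚ; 0ℚ; 1ℚ; _+_; _*_; _-_; -_; _≤_; _/_; toℚᵘ; nonNegative)
  open import Data.Rational.Properties
  import Data.Rational.Unnormalised as ℚᵘ
  import Data.Rational.Unnormalised.Properties as ℚᵘ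
  open import Data.Rational.Solver using (module +-*-Solver)
  open import Data.Sum using (_⊎_; inj₁; inj₂)
  open import Data.Vec as Vec using (Vec; []; _∷_; lookup; _[_]≔_)
  open import Data.Vec.Properties using (lookup∘update; lookup∘update′)
  open import Function using (_∘_; id; const)
  open import Relation.Binary.PropositionalEquality hiding (sym)
  import Relation.Binary.PropositionalEquality as ≡
  open import Relation.Nullary using (¬_; Dec; yes; no; contradiction)
  open import Relation.Nullary.Decidable using (⌊_⌋; _×-dec_; _⊎-dec_; ¬?)
  open import Data.List.Relation.Unary.AllPairs using ([]; _∷_)
  open import Data.Maybe using (Maybe; just; nothing)
  open import Relation.Unary using (Decidable)
  open import Algebra.Bundles using (CommutativeRing)
  open import Algebra.Properties.CommutativeSemiring.Exp (CommutativeRing.commutativeSemiring +-*-commutativeRing) using (_^_)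

  open Embedding
  open TreeEmbedding

  private variable
    l : ℕ
    X Y : Set

  *-monoˡ : ∀ {c a b} → 0ℚ ≤ c → a ≤ b → c * a ≤ c * b
  *-monoˡ {c} 0≤c = *-monoˡ-≤-nonNeg c {{nonNegative 0≤c}}

  *-monoʳ : ∀ {c a b} → 0ℚ ≤ c → a ≤ b → a * c ≤ b * c
  *-monoʳ {c} 0≤c = *-monoʳ-≤-nonNeg c {{nonNegative 0≤c}}

  0≤* : ∀ {a b} → 0ℚ ≤ a → 0ℚ ≤ b → 0ℚ ≤ a * b
  0≤* {a} {b} 0≤a 0≤b = ≤-trans (≤-reflexive (≡.sym (*-zeroʳ a))) (*-monoˡ 0≤a 0≤b)

  0≤+ : ∀ {a b} → 0ℚ ≤ a → 0ℚ ≤ b → 0ℚ ≤ a + b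
  0≤+ = +-mono-≤

  0≤1 : 0ℚ ≤ 1ℚ
  0≤1 = nonNegative⁻¹ 1ℚ

  0≤1- : ∀ {a} → a ≤ 1ℚ → 0ℚ ≤ 1ℚ - a
  0≤1- {a} a≤1 = ≤-trans (≤-reflexive (≡.sym (+-inverseʳ a))) (+-monoˡ-≤ (- a) a≤1)

  1-≤1 : ∀ {a} → 0ℚ ≤ a → 1ℚ - a ≤ 1ℚ
  1-≤1 {a} 0≤a = +-monoʳ-≤ 1ℚ (neg-antimono-≤ 0≤a)

  fromℕ : ℕ → ℚ
  fromℕ n = + n / 1

  fromℕ-+ : ∀ a b → fromℕ (a ℕ.+ b) ≡ fromℕ a + fromℕ b
  fromℕ-+ a b = toℚᵘ-injective (begin
    toℚᵘ (fromℕ (a ℕ.+ b))                ≈⟨ toℚᵘ-fromℚᵘ (ℚᵘ.mkℚᵘ (+ (a ℕ.+ b)) 0) ⟩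
    ℚᵘ.mkℚᵘ (+ (a ℕ.+ b)) 0
      ≈⟨ ℚᵘ.*≡* (cong (ℤ._* + 1) (≡.sym (cong₂ ℤ._+_ (ℤ.*-identityʳ (+ a)) (ℤ.*-identityʳ (+ b))))) ⟩
    ℚᵘ.mkℚᵘ (+ a) 0 ℚᵘ.+ ℚᵘ.mkℚᵘ (+ b) 0
      ≈⟨ ℚᵘ.+-cong (toℚᵘ-fromℚᵘ (ℚᵘ.mkℚᵘ (+ a) 0)) (toℚᵘ-fromℚᵘ (ℚᵘ.mkℚᵘ (+ b) 0)) ⟨
    toℚᵘ (fromℕ a) ℚᵘ.+ toℚᵘ (fromℕ b)   ≈⟨ toℚᵘ-homo-+ (fromℕ a) (fromℕ b) ⟨
    toℚᵘ (fromℕ a + fromℕ b)              ∎)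
    where open ℚᵘ.≃-Reasoning

  fromℕ-* : ∀ a b → fromℕ (a ℕ.* b) ≡ fromℕ a * fromℕ b
  fromℕ-* zero b = ≡.sym (*-zeroˡ (fromℕ b))
  fromℕ-* (suc a) b = begin
    fromℕ (b ℕ.+ a ℕ.* b)       ≡⟨ fromℕ-+ b (a ℕ.* b) ⟩
    fromℕ b + fromℕ (a ℕ.* b)   ≡⟨ cong₂ _+_ (≡.sym (*-identityˡ (fromℕ b))) (fromℕ-* a b) ⟩
    1ℚ * fromℕ b + fromℕ a * fromℕ b ≡⟨ *-distribʳ-+ (fromℕ b) 1ℚ (fromℕ a) ⟨
    (1ℚ + fromℕ a) * fromℕ b    ≡⟨ cong (_* fromℕ b) (fromℕ-+ 1 a) ⟨
    fromℕ (suc a) * fromℕ b      ∎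
    where open ≡-Reasoning

  0≤fromℕ : ∀ n → 0ℚ ≤ fromℕ n
  0≤fromℕ n = nonNegative⁻¹ (fromℕ n) {{normalize-nonNeg n 1}}

  fromℕ-mono : ∀ {a b} → a ℕ.≤ b → fromℕ a ≤ fromℕ b
  fromℕ-mono {a} {b} a≤b = begin
    fromℕ a                  ≡⟨ +-identityʳ (fromℕ a) ⟨
    fromℕ a + 0ℚ             ≤⟨ +-monoʳ-≤ (fromℕ a) (0≤fromℕ (b ℕ.∸ a)) ⟩
    fromℕ a + fromℕ (b ℕ.∸ a) ≡⟨ fromℕ-+ a (b ℕ.∸ a) ⟨
    fromℕ (a ℕ.+ (b ℕ.∸ a)) ≡⟨ cong fromℕ (ℕ.m+[n∸m]≡n a≤b) ⟩
    fromℕ b                  ∎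
    where open ≤-Reasoning

  fromℕ-cancel : ∀ {a b} → fromℕ a ≤ fromℕ b → a ℕ.≤ b
  fromℕ-cancel {a} {b} a≤b with ℕ.≤-total a b
  ... | inj₁ le = le
  ... | inj₂ b≤a = ℕ.≤-reflexive (eq (≤-antisym a≤b (fromℕ-mono b≤a)))
    where
    eq : fromℕ a ≡ fromℕ b → a ≡ b
    eq e with /-injective-≃ (ℚᵘ.mkℚᵘ (+ a) 0) (ℚᵘ.mkℚᵘ (+ b) 0) e
    ... | ℚᵘ.*≡* p = ℤ.+-injective (trans (≡.sym (ℤ.*-identityʳ (+ a))) (trans p (ℤ.*-identityʳ (+ b))))

  fromℕ-recip : ∀ n .{{_ : ℕ.NonZero n}} → fromℕ n * (+ 1 / n) ≡ 1ℚ
  fromℕ-recip (suc n) = toℚᵘ-injective (begin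
    toℚᵘ (fromℕ (suc n) * (+ 1 / suc n))                 ≈⟨ toℚᵘ-homo-* (fromℕ (suc n)) (+ 1 / suc n) ⟩
    toℚᵘ (fromℕ (suc n)) ℚᵘ.* toℚᵘ (+ 1 / suc n)
      ≈⟨ ℚᵘ.*-cong (toℚᵘ-fromℚᵘ (ℚᵘ.mkℚᵘ (+ suc n) 0)) (toℚᵘ-fromℚᵘ (ℚᵘ.mkℚᵘ (+ 1) n)) ⟩
    ℚᵘ.mkℚᵘ (+ suc n) 0 ℚᵘ.* ℚᵘ.mkℚᵘ (+ 1) n
      ≈⟨ ℚᵘ.*≡* (trans (cong (ℤ._* + 1) (ℤ.*-identityʳ (+ suc n)))
          (trans (ℤ.*-comm (+ suc n) (+ 1)) (cong (λ x → + 1 ℤ.* + x) (≡.sym (ℕ.*-identityˡ (suc n)))))) ⟩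
    ℚᵘ.1ℚᵘ                                               ∎)
    where open ℚᵘ.≃-Reasoning

  -- Weights need not sum to 1. With unit weights `avg` is a plain sum, so the union bound can reuse
  -- the interchange of averages.
  Dist : Set → Set
  Dist X = List (ℚ × X)

  avg : Dist X → (X → ℚ) → ℚ
  avg []            f = 0ℚ
  avg ((w , x) ∷ μ) f = w * f x + avg μ f

  NonNeg : Dist X → Set
  NonNeg = All (λ wx → 0ℚ ≤ proj₁ wx)

  avg-mono : {μ : Dist X} → NonNeg μ → {f g : X → ℚ} → (∀ x → f x ≤ g x) → avg μ f ≤ avg μ g
  avg-mono [] f≤g = ≤-refl
  avg-mono (0≤w ∷ nn) f≤g = +-mono-≤ (*-monoˡ 0≤w (f≤g _)) (avg-mono nn f≤g)

  avg-cong : (μ : Dist X) {f g : X → ℚ} → (∀ x → f x ≡ g x) → avg μ f ≡ avg μ g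
  avg-cong [] f≡g = refl
  avg-cong ((w , x) ∷ μ) f≡g = cong₂ (λ a b → w * a + b) (f≡g x) (avg-cong μ f≡g)

  avg-+ : (μ : Dist X) (f g : X → ℚ) → avg μ (λ x → f x + g x) ≡ avg μ f + avg μ g
  avg-+ [] f g = refl
  avg-+ ((w , x) ∷ μ) f g = trans (cong (λ z → w * (f x + g x) + z) (avg-+ μ f g))
    (solve 5 (λ w a b c d → w :* (a :+ b) :+ (c :+ d) := w :* a :+ c :+ (w :* b :+ d)) refl w (f x) (g x) (avg μ f) (avg μ g))
    where open +-*-Solver

  avg-* : (μ : Dist X) (c : ℚ) (f : X → ℚ) → avg μ (λ x → c * f x) ≡ c * avg μ f
  avg-* [] c f = ≡.sym (*-zeroʳ c)
  avg-* ((w , x) ∷ μ) c f = trans (cong (λ z → w * (c * f x) + z) (avg-* μ c f))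
    (solve 4 (λ w c a b → w :* (c :* a) :+ c :* b := c :* (w :* a :+ b)) refl w c (f x) (avg μ f))
    where open +-*-Solver

  avg-zero : (μ : Dist X) → avg μ (const 0ℚ) ≡ 0ℚ
  avg-zero [] = refl
  avg-zero ((w , x) ∷ μ) = trans (cong₂ _+_ (*-zeroʳ w) (avg-zero μ)) refl

  E : Dist X → (l : ℕ) → (Vec X l → ℚ) → ℚ
  E μ zero    f = f []
  E μ (suc l) f = avg μ (λ x → E μ l (f ∘ (x ∷_)))

  E-mono : {μ : Dist X} → NonNeg μ → ∀ l {f g : Vec X l → ℚ} → (∀ v → f v ≤ g v) → E μ l f ≤ E μ l g
  E-mono nn zero    f≤g = f≤g []
  E-mono nn (suc l) f≤g = avg-mono nn λ x → E-mono nn l λ v → f≤g (x ∷ v)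

  E-cong : (μ : Dist X) → ∀ l {f g : Vec X l → ℚ} → (∀ v → f v ≡ g v) → E μ l f ≡ E μ l g
  E-cong μ zero    f≡g = f≡g []
  E-cong μ (suc l) f≡g = avg-cong μ λ x → E-cong μ l λ v → f≡g (x ∷ v)

  E-+ : (μ : Dist X) → ∀ l (f g : Vec X l → ℚ) → E μ l (λ v → f v + g v) ≡ E μ l f + E μ l g
  E-+ μ zero    f g = refl
  E-+ μ (suc l) f g = trans (avg-cong μ λ x → E-+ μ l (f ∘ (x ∷_)) (g ∘ (x ∷_)))
    (avg-+ μ (λ x → E μ l (f ∘ (x ∷_))) (λ x → E μ l (g ∘ (x ∷_))))

  E-* : (μ : Dist X) → ∀ l c (f : Vec X l → ℚ) → E μ l (λ v → c * f v) ≡ c * E μ l f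
  E-* μ zero    c f = refl
  E-* μ (suc l) c f = trans (avg-cong μ λ x → E-* μ l c (f ∘ (x ∷_))) (avg-* μ c (λ x → E μ l (f ∘ (x ∷_))))

  E-zero : (μ : Dist X) → ∀ l → E μ l (const 0ℚ) ≡ 0ℚ
  E-zero μ zero    = refl
  E-zero μ (suc l) = trans (avg-cong μ λ _ → E-zero μ l) (avg-zero μ)

  E-one : (μ : Dist X) → avg μ (const 1ℚ) ≡ 1ℚ → ∀ l → E μ l (const 1ℚ) ≡ 1ℚ
  E-one μ total zero    = refl
  E-one μ total (suc l) = trans (avg-cong μ λ _ → E-one μ total l) total

  -- Fubini for finite sums; `E` is the expectation over independent coordinates, written as
  -- iterated averages.
  avg-E-swap : (μ : Dist X) (ν : Dist Y) → ∀ l (F : X → Vec Y l → ℚ) →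
               avg μ (λ x → E ν l (F x)) ≡ E ν l (λ v → avg μ (λ x → F x v))
  avg-E-swap []            ν l F = ≡.sym (E-zero ν l)
  avg-E-swap ((w , x) ∷ μ) ν l F = begin
    w * E ν l (F x) + avg μ (λ x → E ν l (F x))
      ≡⟨ cong₂ _+_ (≡.sym (E-* ν l w (F x))) (avg-E-swap μ ν l F) ⟩
    E ν l (λ v → w * F x v) + E ν l (λ v → avg μ (λ x → F x v))        ≡⟨ E-+ ν l _ _ ⟨
    E ν l (λ v → w * F x v + avg μ (λ x → F x v))                      ∎
    where open ≡-Reasoning

  relabel : (X → Y) → Dist X → Dist Y
  relabel h = List.map (λ (w , x) → w , h x)

  avg-relabel : (h : X → Y) (μ : Dist X) (f : Y → ℚ) → avg (relabel h μ) f ≡ avg μ (f ∘ h)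
  avg-relabel h [] f = refl
  avg-relabel h ((w , x) ∷ μ) f = cong (λ z → w * f (h x) + z) (avg-relabel h μ f)

  E-relabel : (h : X → Y) (μ : Dist X) → ∀ l (f : Vec Y l → ℚ) → E (relabel h μ) l f ≡ E μ l (f ∘ Vec.map h)
  E-relabel h μ zero    f = refl
  E-relabel h μ (suc l) f = trans (avg-relabel h μ (λ y → E (relabel h μ) l (f ∘ (y ∷_))))
    (avg-cong μ λ x → E-relabel h μ l (f ∘ (h x ∷_)))

  -- The hybrid argument: coordinates are moved from α to β one at a time.
  E-exchange : {α β : Dist X} → NonNeg α → NonNeg β → X → ∀ l (f : Vec X l → ℚ) →
    (∀ i v → avg α (λ x → f (v [ i ]≔ x)) ≤ avg β (λ x → f (v [ i ]≔ x))) → E α l f ≤ E β l f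
  E-exchange nα nβ x₀ zero f swap = ≤-refl
  E-exchange {α = α} {β} nα nβ x₀ (suc l) f swap = begin
    avg α (λ x → E α l (f ∘ (x ∷_)))
      ≤⟨ avg-mono nα (λ x → E-exchange nα nβ x₀ l (f ∘ (x ∷_)) λ i v → swap (suc i) (x ∷ v)) ⟩
    avg α (λ x → E β l (f ∘ (x ∷_)))       ≡⟨ avg-E-swap α β l (λ x → f ∘ (x ∷_)) ⟩
    -- The tail has been exchanged under a fixed head; after the interchange the head is exchanged
    -- under a fixed tail. The entry `x₀` is only a placeholder that the update overwrites.
    E β l (λ v → avg α (λ x → f (x ∷ v)))  ≤⟨ E-mono nβ l (λ v → swap zero (x₀ ∷ v)) ⟩
    E β l (λ v → avg β (λ x → f (x ∷ v)))  ≡⟨ avg-E-swap β β l (λ x → f ∘ (x ∷_)) ⟨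
    avg β (λ x → E β l (f ∘ (x ∷_)))       ∎
    where open ≤-Reasoning

  ind : Bool → ℚ
  ind true  = 1ℚ
  ind false = 0ℚ

  0≤ind : ∀ b → 0ℚ ≤ ind b
  0≤ind true  = 0≤1
  0≤ind false = ≤-refl

  ind≤1 : ∀ b → ind b ≤ 1ℚ
  ind≤1 true  = ≤-refl
  ind≤1 false = 0≤1

  -- A wild cell is an edge whose colour is not chosen yet: it conflicts with nothing.
  data Cell (n : ℕ) : Set where
    absent wild : Cell n
    col         : Fin n → Cell n

  -- Coordinate lists that are present with distinct colours

  module _ {n : ℕ} where

    Distinct : Cell n → Cell n → Set
    Distinct x y = ∀ c → x ≡ col c → y ≢ col c

    distinct? : ∀ x y → Dec (Distinct x y)
    distinct? absent y = yes λ _ ()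
    distinct? wild y = yes λ _ ()
    distinct? (col c) absent = yes λ _ _ ()
    distinct? (col c) wild = yes λ _ _ ()
    distinct? (col c) (col d) with c Fin.≟ d
    ... | yes refl = no λ f → f c refl refl
    ... | no c≢d = yes λ { _ refl refl → c≢d refl }

    absent? : (x : Cell n) → Dec (x ≡ absent)
    absent? absent = yes refl
    absent? wild = no λ ()
    absent? (col _) = no λ ()

    -- A list `h` stands for the edge set of a possible copy. On cells from `uncoloured` the second
    -- clause is vacuous and only presence is asked; on cells from `cell` it says rainbow. The
    -- alternative `i ≡ j` exempts a coordinate compared with itself.
    Compatible : Vec (Cell n) l → List (Fin l) → Set
    Compatible v h = All (λ i → lookup v i ≢ absent) h ×
                     All (λ i → All (λ j → i ≡ j ⊎ Distinct (lookup v i) (lookup v j)) h) h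

    compatible? : (v : Vec (Cell n) l) → ∀ h → Dec (Compatible v h)
    compatible? v h = All.all? (λ i → ¬? (absent? (lookup v i))) h ×-dec
      All.all? (λ i → All.all? (λ j → (i Fin.≟ j) ⊎-dec distinct? (lookup v i) (lookup v j)) h) h

    hit? : (H : List (List (Fin l))) (v : Vec (Cell n) l) → Dec (Any (Compatible v) H)
    hit? H v = Any.any? (compatible? v) H

    palette : Vec (Cell n) l → List (Fin l) → List (Fin n)
    palette v [] = []
    palette v (i ∷ h) with lookup v i
    ... | col c = c ∷ palette v h
    ... | _     = palette v h

    palette-length : (v : Vec (Cell n) l) → ∀ h → length (palette v h) ℕ.≤ length h
    palette-length v [] = z≤n
    palette-length v (i ∷ h) with lookup v i
    ... | col c  = s≤s (palette-length v h)
    ... | absent = ℕ.m≤n⇒m≤1+n (palette-length v h)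
    ... | wild   = ℕ.m≤n⇒m≤1+n (palette-length v h)

    ∈-palette : (v : Vec (Cell n) l) → ∀ {h i c} → i ∈ h → lookup v i ≡ col c → c ∈ palette v h
    ∈-palette v {i ∷ h} (here refl) e rewrite e = here refl
    ∈-palette v {j ∷ h} (there p) e with lookup v j
    ... | col d  = there (∈-palette v p e)
    ... | absent = ∈-palette v p e
    ... | wild   = ∈-palette v p e

    -- An absent cell cannot lie on a compatible list, so its content is irrelevant.
    compatible-fill : (v : Vec (Cell n) l) (i : Fin l) → ∀ h x → Compatible (v [ i ]≔ absent) h → Compatible (v [ i ]≔ x) h
    compatible-fill v i h x (present , distinct) =
      All.tabulate (λ {j} p → subst (_≢ absent) (same p) (All.lookup present p)) ,
      All.tabulate (λ {j} p → All.tabulate λ {j′} p′ → subst₂ (λ a b → j ≡ j′ ⊎ Distinct a b) (same p) (same p′)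
        (All.lookup (All.lookup distinct p) p′))
      where
      same : ∀ {j} → j ∈ h → lookup (v [ i ]≔ absent) j ≡ lookup (v [ i ]≔ x) j
      same {j} p with j Fin.≟ i
      ... | yes refl = contradiction (lookup∘update i v absent) (All.lookup present p)
      ... | no j≢i = trans (lookup∘update′ j≢i v absent) (≡.sym (lookup∘update′ j≢i v x))

    -- The wild cell at `i` adds nothing to the palette, so a colour outside it is new with respect
    -- to all the other coordinates of `h`.
    compatible-colour : (v : Vec (Cell n) l) (i : Fin l) → ∀ h c → Compatible (v [ i ]≔ wild) h →
      c ∉ palette (v [ i ]≔ wild) h → Compatible (v [ i ]≔ col c) h
    compatible-colour v i h c (present , distinct) c∉ =
      All.tabulate present′ , All.tabulate λ {j} p → All.tabulate λ {j′} p′ → distinct′ p p′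
      where
      at : lookup (v [ i ]≔ col c) i ≡ col c
      at = lookup∘update i v (col c)
      same : ∀ {j} → j ≢ i → lookup (v [ i ]≔ wild) j ≡ lookup (v [ i ]≔ col c) j
      same j≢i = trans (lookup∘update′ j≢i v wild) (≡.sym (lookup∘update′ j≢i v (col c)))
      present′ : ∀ {j} → j ∈ h → lookup (v [ i ]≔ col c) j ≢ absent
      present′ {j} p with j Fin.≟ i
      ... | yes refl = λ e → contradiction (trans (≡.sym at) e) λ ()
      ... | no j≢i = subst (_≢ absent) (same j≢i) (All.lookup present p)
      new : ∀ {j d} → j ∈ h → j ≢ i → lookup (v [ i ]≔ col c) j ≡ col d → d ≢ c
      new p j≢i e refl = c∉ (∈-palette (v [ i ]≔ wild) p (trans (same j≢i) e))
      col-injective : ∀ {c d} → Cell.col c ≡ col d → c ≡ d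
      col-injective refl = refl
      distinct′ : ∀ {j j′} → j ∈ h → j′ ∈ h → j ≡ j′ ⊎ Distinct (lookup (v [ i ]≔ col c) j) (lookup (v [ i ]≔ col c) j′)
      distinct′ {j} {j′} p p′ with j Fin.≟ i | j′ Fin.≟ i
      ... | yes refl | yes refl = inj₁ refl
      ... | yes refl | no j′≢i = inj₂ λ d e e′ → new p′ j′≢i e′ (col-injective (trans (≡.sym e) at))
      ... | no j≢i | yes refl = inj₂ λ d e e′ → new p j≢i e (col-injective (trans (≡.sym e′) at))
      ... | no j≢i | no j′≢i = subst₂ (λ a b → j ≡ j′ ⊎ Distinct a b) (same j≢i) (same j′≢i) (All.lookup (All.lookup distinct p) p′)

  -- The two distributions of a single pair and their comparison

  bern : ℚ → Dist Bool
  bern q = (q , true) ∷ (1ℚ - q , false) ∷ []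

  bern-NonNeg : ∀ {q} → 0ℚ ≤ q → q ≤ 1ℚ → NonNeg (bern q)
  bern-NonNeg 0≤q q≤1 = 0≤q ∷ 0≤1- q≤1 ∷ []

  bern-total : ∀ q → avg (bern q) (const 1ℚ) ≡ 1ℚ
  bern-total q = solve 1 (λ q → q :* con 1ℚ :+ ((con 1ℚ :+ :- q) :* con 1ℚ :+ con 0ℚ) := con 1ℚ) refl q
    where open +-*-Solver

  uncoloured : ∀ {n} → Bool → Cell n
  uncoloured true  = wild
  uncoloured false = absent

  ind-yes : ∀ {P : Set} (P? : Dec P) → P → ind ⌊ P? ⌋ ≡ 1ℚ
  ind-yes (yes _) p = refl
  ind-yes (no ¬p) p = contradiction p ¬p

  ind-no : ∀ {P : Set} (P? : Dec P) → ¬ P → ind ⌊ P? ⌋ ≡ 0ℚ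
  ind-no (yes p) ¬p = contradiction p ¬p
  ind-no (no _) ¬p = refl

  weighted : (X → ℚ) → List X → Dist X
  weighted w = List.map (λ x → w x , x)

  weighted-NonNeg : {w : X → ℚ} → (∀ x → 0ℚ ≤ w x) → ∀ xs → NonNeg (weighted w xs)
  weighted-NonNeg 0≤w [] = []
  weighted-NonNeg 0≤w (x ∷ xs) = 0≤w x ∷ weighted-NonNeg 0≤w xs

  relabel-NonNeg : (h : X → Y) {μ : Dist X} → NonNeg μ → NonNeg (relabel h μ)
  relabel-NonNeg h [] = []
  relabel-NonNeg h (p ∷ nn) = p ∷ relabel-NonNeg h nn

  avg-++ : (μ ν : Dist X) (f : X → ℚ) → avg (μ ++ ν) f ≡ avg μ f + avg ν f
  avg-++ [] ν f = ≡.sym (+-identityˡ _)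
  avg-++ ((w , x) ∷ μ) ν f = trans (cong (λ z → w * f x + z) (avg-++ μ ν f)) (≡.sym (+-assoc (w * f x) _ _))

  allMaybe : ∀ n → List (Maybe (Fin n))
  allMaybe n = nothing ∷ List.map just (allFin n)

  outcomeDist : ∀ n → ℚ → Dist (Maybe (Fin n))
  outcomeDist n p = weighted (coordWeight n p) (allMaybe n)

  cell : ∀ {n} → Maybe (Fin n) → Cell n
  cell nothing  = absent
  cell (just c) = col c

  module Exchange (n′ : ℕ) (p q : ℚ) (0≤p : 0ℚ ≤ p) (p≤1 : p ≤ 1ℚ) (0≤q : 0ℚ ≤ q) (q≤1 : q ≤ 1ℚ) where

    private
      n = suc n′
      w = p * (+ 1 / n)

    0≤w : 0ℚ ≤ w
    0≤w = 0≤* 0≤p (nonNegative⁻¹ (+ 1 / n) {{normalize-nonNeg 1 n}})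

    0≤coordWeight : ∀ x → 0ℚ ≤ coordWeight n p x
    0≤coordWeight nothing  = 0≤1- p≤1
    0≤coordWeight (just _) = 0≤w

    outcomeDist-NonNeg : NonNeg (outcomeDist n p)
    outcomeDist-NonNeg = weighted-NonNeg 0≤coordWeight (allMaybe n)

    private
      w-suc : ∀ a → w + w * fromℕ a ≡ w * fromℕ (suc a)
      w-suc a = trans (cong (_+ w * fromℕ a) (≡.sym (*-identityʳ w)))
               (trans (≡.sym (*-distribˡ-+ w 1ℚ (fromℕ a))) (cong (w *_) (≡.sym (fromℕ-+ 1 a))))

    colours-total : ∀ cs → avg (weighted (coordWeight n p) (List.map just cs)) (const 1ℚ) ≡ w * fromℕ (length cs)
    colours-total [] = ≡.sym (*-zeroʳ w)
    colours-total (c ∷ cs) = trans (cong₂ _+_ (*-identityʳ w) (colours-total cs)) (w-suc (length cs))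

    outcomeDist-total : avg (outcomeDist n p) (const 1ℚ) ≡ 1ℚ
    outcomeDist-total = begin
      (1ℚ - p) * 1ℚ + avg (weighted (coordWeight n p) (List.map just (allFin n))) (const 1ℚ)
        ≡⟨ cong (λ z → (1ℚ - p) * 1ℚ + z) (trans (colours-total (allFin n))
            (cong (λ z → w * fromℕ z) (length-tabulate {n = n} id))) ⟩
      (1ℚ - p) * 1ℚ + p * (+ 1 / n) * fromℕ n
        ≡⟨ solve 3 (λ p r m → (con 1ℚ :+ :- p) :* con 1ℚ :+ p :* r :* m := (con 1ℚ :+ :- p) :+ p :* (m :* r)) refl p
            (+ 1 / n) (fromℕ n) ⟩
      (1ℚ - p) + p * (fromℕ n * (+ 1 / n)) ≡⟨ cong (λ z → (1ℚ - p) + p * z) (fromℕ-recip n) ⟩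
      (1ℚ - p) + p * 1ℚ ≡⟨ solve 1 (λ p → (con 1ℚ :+ :- p) :+ p :* con 1ℚ := con 1ℚ) refl p ⟩
      1ℚ ∎
      where
      open ≡-Reasoning
      open +-*-Solver

    colours-lower : {P : Fin n → Set} (P? : Decidable P) (f : Maybe (Fin n) → ℚ) → (∀ x → 0ℚ ≤ f x) →
      (∀ c → P c → f (just c) ≡ 1ℚ) → ∀ cs →
      w * fromℕ (length (filter P? cs)) ≤ avg (weighted (coordWeight n p) (List.map just cs)) f
    colours-lower P? f 0≤f good [] = ≤-reflexive (*-zeroʳ w)
    colours-lower P? f 0≤f good (c ∷ cs) with P? c
    ... | yes pc = ≤-trans (≤-reflexive (≡.sym (w-suc (length (filter P? cs)))))
            (+-mono-≤ (≤-reflexive (≡.sym (trans (cong (w *_) (good c pc)) (*-identityʳ w)))) (colours-lower P? f 0≤f good cs))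
    ... | no _ = ≤-trans (≤-reflexive (≡.sym (+-identityˡ (w * fromℕ (length (filter P? cs)))))) (+-mono-≤ (0≤* 0≤w (0≤f (just c))) (colours-lower P? f 0≤f good cs))

    unused-count : ∀ (used : List (Fin n)) {e} → length used ℕ.≤ e →
      let open DecMembership (Fin._≟_ {n}) in n ℕ.∸ e ℕ.≤ length (filter (λ c → ¬? (c ∈? used)) (allFin n))
    unused-count used {e} le = ℕ.≤-trans (ℕ.∸-monoʳ-≤ n le) (ℕ.m≤n+o⇒m∸n≤o n (length used) (begin
      n                                       ≡⟨ length-tabulate {n = n} id ⟨
      length (allFin n)                       ≤⟨ unique-⊆-length (Unique.allFin⁺ n) cover′ ⟩
      length (used ++ filter new? (allFin n)) ≡⟨ length-++ used ⟩
      length used ℕ.+ length (filter new? (allFin n)) ∎))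
      where
      open ℕ.≤-Reasoning
      open DecMembership (Fin._≟_ {n}) using (_∈?_)
      new? : Decidable (_∉ used)
      new? c = ¬? (c ∈? used)
      cover′ : ∀ {c} → c ∈ allFin n → c ∈ used ++ filter new? (allFin n)
      cover′ {c} p with c ∈? used
      ... | yes q = ∈-++⁺ˡ q
      ... | no c∉ = ∈-++⁺ʳ used (∈-filter⁺ new? p c∉)

    rainbow-exchange : (H : List (List (Fin l))) (e : ℕ) → All (λ h → length h ℕ.≤ e) H → q ≤ w * fromℕ (n ℕ.∸ e) →
      E (bern q) l (λ v → ind ⌊ hit? {n} H (Vec.map uncoloured v) ⌋) ≤
      E (outcomeDist n p) l (λ v → ind ⌊ hit? {n} H (Vec.map cell v) ⌋)
    rainbow-exchange {l} H e short q≤ = begin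
      E (bern q) l (f ∘ Vec.map uncoloured)     ≡⟨ E-relabel uncoloured (bern q) l f ⟨
      E (relabel uncoloured (bern q)) l f
        ≤⟨ E-exchange (relabel-NonNeg uncoloured (bern-NonNeg 0≤q q≤1))
            (relabel-NonNeg cell outcomeDist-NonNeg) absent l f swap ⟩
      E (relabel cell (outcomeDist n p)) l f    ≡⟨ E-relabel cell (outcomeDist n p) l f ⟩
      E (outcomeDist n p) l (f ∘ Vec.map cell)  ∎
      where
      open ≤-Reasoning
      f : Vec (Cell n) l → ℚ
      f v = ind ⌊ hit? H v ⌋
      swap : ∀ i v → avg (relabel uncoloured (bern q)) (λ x → f (v [ i ]≔ x)) ≤ avg (relabel cell (outcomeDist n p)) (λ x → f (v [ i ]≔ x))
      swap i v = subst₂ _≤_ (≡.sym (avg-relabel uncoloured (bern q) F)) (≡.sym (avg-relabel cell (outcomeDist n p) F))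
          (cases (hit? H (v [ i ]≔ absent)) (hit? H (v [ i ]≔ wild)))
        where
        F : Cell n → ℚ
        F x = f (v [ i ]≔ x)
        cases : Dec (Any (Compatible (v [ i ]≔ absent)) H) → Dec (Any (Compatible (v [ i ]≔ wild)) H) →
                avg (bern q) (F ∘ uncoloured) ≤ avg (outcomeDist n p) (F ∘ cell)
        cases (yes hit) _ = begin
          avg (bern q) (F ∘ uncoloured)
            ≤⟨ avg-mono (bern-NonNeg 0≤q q≤1) (λ x → ind≤1 ⌊ hit? H (v [ i ]≔ uncoloured x) ⌋) ⟩
          avg (bern q) (const 1ℚ)             ≡⟨ trans (bern-total q) (≡.sym outcomeDist-total) ⟩
          avg (outcomeDist n p) (const 1ℚ)
            ≡⟨ avg-cong (outcomeDist n p) (λ x → ind-yes (hit? H (v [ i ]≔ cell x))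
                (Any.map (λ {h} → compatible-fill v i h (cell x)) hit)) ⟨
          avg (outcomeDist n p) (F ∘ cell)    ∎
        cases (no miss) (no miss′) = begin
          q * F wild + ((1ℚ - q) * F absent + 0ℚ)
            ≡⟨ cong₂ (λ a b → q * a + ((1ℚ - q) * b + 0ℚ)) (ind-no (hit? H (v [ i ]≔ wild)) miss′)
                (ind-no (hit? H (v [ i ]≔ absent)) miss) ⟩
          q * 0ℚ + ((1ℚ - q) * 0ℚ + 0ℚ)
            ≡⟨ solve 1 (λ q → q :* con 0ℚ :+ ((con 1ℚ :+ :- q) :* con 0ℚ :+ con 0ℚ) := con 0ℚ) refl q ⟩
          0ℚ                                         ≡⟨ avg-zero (outcomeDist n p) ⟨
          avg (outcomeDist n p) (const 0ℚ)
            ≤⟨ avg-mono outcomeDist-NonNeg (λ x → 0≤ind ⌊ hit? H (v [ i ]≔ cell x) ⌋) ⟩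
          avg (outcomeDist n p) (F ∘ cell)           ∎
          where open +-*-Solver
        cases (no miss) (yes hit) = begin
          q * F wild + ((1ℚ - q) * F absent + 0ℚ)
            ≡⟨ cong₂ (λ a b → q * a + ((1ℚ - q) * b + 0ℚ)) (ind-yes (hit? H (v [ i ]≔ wild)) hit)
                (ind-no (hit? H (v [ i ]≔ absent)) miss) ⟩
          q * 1ℚ + ((1ℚ - q) * 0ℚ + 0ℚ)
            ≡⟨ solve 1 (λ q → q :* con 1ℚ :+ ((con 1ℚ :+ :- q) :* con 0ℚ :+ con 0ℚ) := q) refl q ⟩
          q                                          ≤⟨ q≤ ⟩
          w * fromℕ (n ℕ.∸ e)
            ≤⟨ *-monoˡ 0≤w (fromℕ-mono (unused-count used (ℕ.≤-trans (palette-length (v [ i ]≔ wild) h)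
                (All.lookup short h∈H)))) ⟩
          w * fromℕ (length (filter new? (allFin n)))
            ≤⟨ colours-lower new? (F ∘ cell) (λ x → 0≤ind ⌊ hit? H (v [ i ]≔ cell x) ⌋) good (allFin n) ⟩
          tail                                       ≡⟨ +-identityˡ tail ⟨
          0ℚ + tail
            ≤⟨ +-monoˡ-≤ tail (0≤* (0≤1- p≤1) (0≤ind ⌊ hit? H (v [ i ]≔ absent) ⌋)) ⟩
          avg (outcomeDist n p) (F ∘ cell)           ∎
          where
          open +-*-Solver
          open DecMembership (Fin._≟_ {n}) using (_∈?_)
          h = proj₁ (find hit)
          h∈H = proj₁ (proj₂ (find hit))
          used = palette (v [ i ]≔ wild) h
          new? : Decidable (_∉ used)
          new? c = ¬? (c ∈? used)
          tail = avg (weighted (coordWeight n p) (List.map just (allFin n))) (F ∘ cell)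
          good : ∀ c → c ∉ used → F (col c) ≡ 1ℚ
          good c c∉ = ind-yes (hit? H (v [ i ]≔ col c)) (lose h∈H (compatible-colour v i h c (proj₂ (proj₂ (find hit))) c∉))

  -- `coordWeight` computes for present edges only at a successor, hence the case split on `n`.
  coloured-exchange : ∀ n .{{_ : ℕ.NonZero n}} (p q : ℚ) → 0ℚ ≤ p → p ≤ 1ℚ → 0ℚ ≤ q → q ≤ 1ℚ →
    (H : List (List (Fin l))) (e : ℕ) → All (λ h → length h ℕ.≤ e) H → q ≤ p * (+ 1 / n) * fromℕ (n ℕ.∸ e) →
    E (bern q) l (λ v → ind ⌊ hit? {n} H (Vec.map uncoloured v) ⌋) ≤
    E (outcomeDist n p) l (λ v → ind ⌊ hit? {n} H (Vec.map cell v) ⌋)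
  coloured-exchange (suc n′) p q 0≤p p≤1 0≤q q≤1 = Exchange.rainbow-exchange n′ p q 0≤p p≤1 0≤q q≤1

  -- Sums over explicit lists of outcomes as iterated averages

  allVecs : List X → ∀ l → List (Vec X l)
  allVecs xs zero    = [] ∷ []
  allVecs xs (suc l) = cartesianProductWith _∷_ xs (allVecs xs l)

  allVecs-unique : {xs : List X} → Unique xs → ∀ l → Unique (allVecs xs l)
  allVecs-unique u zero    = [] ∷ []
  allVecs-unique u (suc l) = Unique.cartesianProductWith⁺ _∷_ (λ { refl → refl , refl }) u (allVecs-unique u l)

  allVecs-complete : {xs : List X} → (∀ x → x ∈ xs) → (v : Vec X l) → v ∈ allVecs xs l
  allVecs-complete all []      = here refl
  allVecs-complete all (x ∷ v) = ∈-cartesianProductWith⁺ _∷_ (all x) (allVecs-complete all v)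

  vecWeight : (X → ℚ) → Vec X l → ℚ
  vecWeight w v = List.foldr _*_ 1ℚ (List.map w (Vec.toList v))

  -- The weight of a vector is a product, so the sum over all vectors factors coordinate by
  -- coordinate. This links the product weights of the probability space to `E`.
  avg-allVecs : (w : X → ℚ) (xs : List X) → ∀ l (f : Vec X l → ℚ) →
    avg (weighted (vecWeight w) (allVecs xs l)) f ≡ E (weighted w xs) l f
  avg-allVecs w xs zero f = trans (cong (_+ 0ℚ) (*-identityˡ (f []))) (+-identityʳ (f []))
  avg-allVecs {X} w xs (suc l) f = go xs
    where
    V = allVecs xs l
    open ≡-Reasoning
    front : ∀ x (vs : List (Vec X l)) → avg (weighted (vecWeight w) (List.map (x ∷_) vs)) f ≡ w x * avg (weighted (vecWeight w) vs) (f ∘ (x ∷_))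
    front x [] = ≡.sym (*-zeroʳ (w x))
    front x (v ∷ vs) = trans (cong (λ z → w x * vecWeight w v * f (x ∷ v) + z) (front x vs))
      (solve 4 (λ a b c d → a :* b :* c :+ a :* d := a :* (b :* c :+ d)) refl (w x) (vecWeight w v) (f (x ∷ v)) (avg (weighted (vecWeight w) vs) (f ∘ (x ∷_))))
      where open +-*-Solver
    map-++′ : ∀ (as bs : List (Vec X (suc l))) → weighted (vecWeight w) (as ++ bs) ≡ weighted (vecWeight w) as ++ weighted (vecWeight w) bs
    map-++′ [] bs = refl
    map-++′ (a ∷ as) bs = cong (_ ∷_) (map-++′ as bs)
    go : ∀ ys → avg (weighted (vecWeight w) (cartesianProductWith _∷_ ys V)) f ≡ avg (weighted w ys) (λ x → E (weighted w xs) l (f ∘ (x ∷_)))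
    go [] = refl
    go (y ∷ ys) = begin
      avg (weighted (vecWeight w) (List.map (y ∷_) V ++ cartesianProductWith _∷_ ys V)) f
        ≡⟨ cong (λ μ → avg μ f) (map-++′ (List.map (y ∷_) V) _) ⟩
      avg (weighted (vecWeight w) (List.map (y ∷_) V) ++ weighted (vecWeight w) (cartesianProductWith _∷_ ys V)) f
        ≡⟨ avg-++ (weighted (vecWeight w) (List.map (y ∷_) V)) _ f ⟩
      avg (weighted (vecWeight w) (List.map (y ∷_) V)) f + avg (weighted (vecWeight w) (cartesianProductWith _∷_ ys V)) f
        ≡⟨ cong₂ _+_ (trans (front y V) (cong (w y *_) (avg-allVecs w xs l (f ∘ (y ∷_))))) (go ys) ⟩
      w y * E (weighted w xs) l (f ∘ (y ∷_)) + avg (weighted w ys) (λ x → E (weighted w xs) l (f ∘ (x ∷_))) ∎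

  totalWeight-filter : ∀ n p {P : Outcome n → Set} (P? : Decidable P) (L : List (Outcome n)) →
    totalWeight n p (filter P? L) ≡ avg (weighted (weight n p) L) (λ ω → ind ⌊ P? ω ⌋)
  totalWeight-filter n p P? [] = refl
  totalWeight-filter n p P? (ω ∷ L) with P? ω
  ... | yes _ = cong₂ _+_ (≡.sym (*-identityʳ (weight n p ω))) (totalWeight-filter n p P? L)
  ... | no _  = trans (totalWeight-filter n p P? L) (≡.sym (trans (cong (_+ _) (*-zeroʳ (weight n p ω))) (+-identityˡ _)))

  totalWeight-E : ∀ n p {P : Outcome n → Set} (P? : Decidable P) →
    totalWeight n p (filter P? (allVecs (allMaybe n) _)) ≡ E (outcomeDist n p) _ (λ ω → ind ⌊ P? ω ⌋)
  totalWeight-E n p P? = trans (totalWeight-filter n p P? (allVecs (allMaybe n) _))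
      (avg-allVecs (coordWeight n p) (allMaybe n) (length (pairs n)) (λ ω → ind ⌊ P? ω ⌋))

  misses : Vec Bool l → Vec Bool l → Bool
  misses []       []       = true
  misses (a ∷ as) (b ∷ bs) = not (a ∧ b) ∧ misses as bs

  -- Independence: each position of `a` contributes a factor 1 - q, every other position averages to
  -- 1.
  E-misses : ∀ q l (a : Vec Bool l) → E (bern q) l (λ b → ind (misses a b)) ≡ (1ℚ - q) ^ size a
  E-misses q zero [] = refl
  E-misses q (suc l) (false ∷ a) = trans (avg-cong (bern q) {g = const (r * 1ℚ)}
      (λ _ → trans (E-misses q l a) (≡.sym (*-identityʳ r))))
    (trans (avg-* (bern q) r (const 1ℚ)) (trans (cong (r *_) (bern-total q)) (*-identityʳ r)))
    where r = (1ℚ - q) ^ size a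
  E-misses q (suc l) (true ∷ a) = begin
    q * E (bern q) l (const 0ℚ) + ((1ℚ - q) * E (bern q) l (λ b → ind (misses a b)) + 0ℚ)
      ≡⟨ cong₂ (λ x y → q * x + ((1ℚ - q) * y + 0ℚ)) (E-zero (bern q) l) (E-misses q l a) ⟩
    q * 0ℚ + ((1ℚ - q) * r + 0ℚ)
      ≡⟨ solve 2 (λ q r → q :* con 0ℚ :+ ((con 1ℚ :+ :- q) :* r :+ con 0ℚ) := (con 1ℚ :+ :- q) :* r) refl q r ⟩
    (1ℚ - q) * r ∎
    where
    open ≡-Reasoning
    open +-*-Solver
    r = (1ℚ - q) ^ size a

  misses-no : (a b : Vec Bool l) → misses a b ≡ false → ∃[ i ] (lookup a i ≡ true × lookup b i ≡ true)
  misses-no [] [] ()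
  misses-no (true ∷ a) (true ∷ b) e = zero , refl , refl
  misses-no (false ∷ a) (x ∷ b) e with misses-no a b e
  ... | i , p = suc i , p
  misses-no (true ∷ a) (false ∷ b) e with misses-no a b e
  ... | i , p = suc i , p

-- Pairs of vertices as coordinates, and copies of the tree as coordinate lists

module Coordinates where

  open import Defs
  open import Data.Bool using (Bool; true; false; _∧_; _∨_; not; if_then_else_)
  open import Data.Bool.Properties using (∧-conicalˡ; ∧-conicalʳ; ¬-not; ∨-comm)
  open import Data.Fin using (Fin; zero; suc)
  import Data.Fin as Fin
  import Data.Fin.Properties as Fin
  open import Data.Fin.Subset using (Subset)
  open import Data.List as List using (List; []; _∷_; length; filter; filterᵇ; allFin; zip; cartesianProduct)
  open import Data.List.Membership.Propositional using (_∈_; find; lose)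
  open import Data.List.Membership.Propositional.Properties
  open import Data.List.Properties using (length-map; length-++; length-filter)
  open import Data.List.Relation.Unary.All as All using (All; []; _∷_)
  open import Data.List.Relation.Unary.Any using (Any; here; there)
  open import Data.List.Relation.Unary.AllPairs using ([]; _∷_)
  open import Data.List.Relation.Unary.Unique.Propositional using (Unique)
  import Data.List.Relation.Unary.Unique.Propositional.Properties as Unique
  open import Data.Maybe using (Maybe; just; nothing)
  open import Data.Nat as ℕ using (ℕ; zero; suc; z≤n; s≤s; _≤_; _<_; _+_; _*_)
  open import Data.Nat.Properties using (≤-trans; ≤-reflexive; m≤n⇒m≤1+n; <-irrefl; <-asym)
  import Data.Nat.Properties as ℕ
  open import Algebra.Properties.CommutativeMonoid.Sum ℕ.+-0-commutativeMonoid using (sum-cong-≗)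
  open import Data.Product using (Σ; _×_; _,_; ∃-syntax; proj₁; proj₂)
  open import Data.Sum using (_⊎_; inj₁; inj₂; swap)
  open import Data.Vec as Vec using (Vec; []; _∷_; lookup; toList; tabulate)
  open import Data.Vec.Properties using (lookup∘tabulate; lookup-map)
  open import Function using (_∘_; id)
  open import Function.Definitions using (Injective)
  open import Relation.Binary.Definitions using (tri<; tri≈; tri>)
  open import Relation.Binary.PropositionalEquality hiding (sym)
  import Relation.Binary.PropositionalEquality as ≡
  open import Relation.Nullary using (¬_; Dec; yes; no; contradiction)
  open import Relation.Nullary.Decidable using (_×-dec_; _→-dec_)
  open import Relation.Unary using (Decidable)

  open Embedding
  open TreeEmbedding
  open Exchanging using (allVecs; allVecs-complete; cell; misses; misses-no; Cell; absent; wild; col; Compatible; uncoloured)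

  private variable
    k n : ℕ
    A : Set

  -- All that the probabilistic part learns about the tree: a short list of edges, complete up to
  -- orientation, and a way to embed it into every joined graph with enough room.
  record Skeleton (T : Graph k) (D : ℕ) : Set where
    field
      es       : List (Fin k × Fin k)
      short    : length es ≤ k
      complete : ∀ u v → Adj T u v → (u , v) ∈ es ⊎ (v , u) ∈ es
      embed    : ∀ {n} (adjG : Fin n → Fin n → Bool) m → 1 ≤ m → Neighbourhood.Joined adjG m →
                 k + (3 * D + 7) * m ≤ n →
                 ∃[ φ ] (Injective _≡_ _≡_ φ × (∀ {u v} → (u , v) ∈ es → adjG (φ u) (φ v) ≡ true))

  skeleton : (T : Graph k) → IsTree T → ∀ D → 1 ≤ D → MaxDegreeAtMost T D → Skeleton T D
  -- The graph without vertices passes as a tree but offers no root to grow from.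
  skeleton {zero} T tree D 1≤D bounded = record
    { es = [] ; short = z≤n ; complete = λ () ; embed = λ _ _ _ _ _ → (λ ()) , (λ { {()} }) , λ () }
  skeleton {suc k} T tree D 1≤D bounded with grow-all tree zero
  ... | S , es , g , all = record
    { es = es
    ; short = ≤-trans (grown-edges g) (grown-length g)
    ; complete = λ u v → grown-complete g (all u) (all v)
    ; embed = λ adjG m 1≤m joined big → let open Embedded (embed-grown T D bounded adjG m 1≤m joined big 1≤D g) in
        φ , (λ {u} {v} → inj u v (all u) (all v)) , edges
    }

  lookup-injective : {xs : List A} → Unique xs → ∀ i j → List.lookup xs i ≡ List.lookup xs j → i ≡ j
  lookup-injective (p ∷ u) zero zero e = refl
  lookup-injective {xs = x ∷ xs} (p ∷ u) zero (suc j) e = contradiction e (All.lookup p (∈-lookup j))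
  lookup-injective {xs = x ∷ xs} (p ∷ u) (suc i) zero e = contradiction (≡.sym e) (All.lookup p (∈-lookup i))
  lookup-injective (p ∷ u) (suc i) (suc j) e = cong suc (lookup-injective u i j e)

  Matches : Fin n × Fin n → Fin n → Fin n → Set
  Matches e u v = e ≡ (u , v) ⊎ e ≡ (v , u)

  -- This is literally the condition in `findCol`, so its value can be substituted there.
  test : Fin n → Fin n → Fin n → Fin n → Bool
  test a b u v = (a is u ∧ b is v) ∨ (a is v ∧ b is u)

  test-sound : (a b u v : Fin n) → test a b u v ≡ true → Matches (a , b) u v
  test-sound a b u v e with a Fin.≟ u | b Fin.≟ v | a Fin.≟ v | b Fin.≟ u
  ... | yes refl | yes refl | _ | _ = inj₁ refl
  ... | yes _ | no _ | yes refl | yes refl = inj₂ refl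
  ... | no _ | _ | yes refl | yes refl = inj₂ refl

  test-complete : (a b u v : Fin n) → Matches (a , b) u v → test a b u v ≡ true
  test-complete a b u v (inj₁ refl) rewrite is-refl a | is-refl b = refl
  test-complete a b u v (inj₂ refl) with a is u ∧ b is v
  ... | true = refl
  ... | false = cong₂ _∧_ (is-refl a) (is-refl b)

  findCol-sym : ∀ xs (u v : Fin n) → findCol xs u v ≡ findCol xs v u
  findCol-sym [] u v = refl
  findCol-sym (((a , b) , c) ∷ xs) u v =
    cong₂ (λ t r → if t then c else r) (∨-comm (a is u ∧ b is v) (a is v ∧ b is u)) (findCol-sym xs u v)

  -- The index depends only on the list and the two vertices. It is chosen before the outcome, so a
  -- copy becomes a fixed list of coordinates.
  locate-in : ∀ ps (u v : Fin n) → (u , v) ∈ ps ⊎ (v , u) ∈ ps →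
    Σ (Fin (length ps)) λ i → Matches (List.lookup ps i) u v ×
      (∀ (ω : Vec (Maybe (Fin n)) (length ps)) → findCol (zip ps (toList ω)) u v ≡ lookup ω i)
  locate-in [] u v (inj₁ ())
  locate-in [] u v (inj₂ ())
  locate-in ((a , b) ∷ ps) u v mem with test a b u v in eq
  ... | true = zero , test-sound a b u v eq , λ { (x ∷ ω) → cong (λ t → if t then x else findCol (zip ps (toList ω)) u v) eq }
  ... | false with locate-in ps u v (tail mem)
    where
    tail : (u , v) ∈ (a , b) ∷ ps ⊎ (v , u) ∈ (a , b) ∷ ps → (u , v) ∈ ps ⊎ (v , u) ∈ ps
    tail (inj₁ (there p)) = inj₁ p
    tail (inj₂ (there p)) = inj₂ p
    tail (inj₁ (here refl)) = contradiction (trans (≡.sym (test-complete a b u v (inj₁ refl))) eq) λ ()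
    tail (inj₂ (here refl)) = contradiction (trans (≡.sym (test-complete a b u v (inj₂ refl))) eq) λ ()
  ...   | i , mt , f = suc i , mt , λ { (x ∷ ω) → trans (cong (λ t → if t then x else findCol (zip ps (toList ω)) u v) eq) (f ω) }

  ordered? : Decidable (λ (ij : Fin n × Fin n) → proj₁ ij Fin.< proj₂ ij)
  ordered? ij = proj₁ ij Fin.<? proj₂ ij

  ∈-pairs : {u v : Fin n} → u Fin.< v → (u , v) ∈ pairs n
  ∈-pairs {n} u<v = ∈-filter⁺ ordered? (∈-cartesianProduct⁺ (∈-allFin _) (∈-allFin _)) u<v

  pairs-ordered : ∀ n i → let (u , v) = List.lookup (pairs n) i in u Fin.< v
  pairs-ordered n i = proj₂ (∈-filter⁻ ordered? {xs = cartesianProduct (allFin n) (allFin n)} (∈-lookup {xs = pairs n} i))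

  locate : {u v : Fin n} → u ≢ v → Σ (Fin (length (pairs n))) λ i →
    Matches (List.lookup (pairs n) i) u v × (∀ ω → edgeCol ω u v ≡ lookup ω i)
  locate {n} {u} {v} u≢v = locate-in (pairs n) u v mem
    where
    mem : (u , v) ∈ pairs n ⊎ (v , u) ∈ pairs n
    mem with Fin.<-cmp u v
    ... | tri< u<v _ _ = inj₁ (∈-pairs u<v)
    ... | tri≈ _ u≡v _ = contradiction u≡v u≢v
    ... | tri> _ _ v<u = inj₂ (∈-pairs v<u)

  -- `pairs` has no repetitions and lists each pair in increasing order only, so the two
  -- orientations cannot sit at different indices.
  index-unique : ∀ {u v : Fin n} i j → Matches (List.lookup (pairs n) i) u v → Matches (List.lookup (pairs n) j) u v → i ≡ j
  index-unique {n} {u} {v} i j = cases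
    where
    same : List.lookup (pairs n) i ≡ List.lookup (pairs n) j → i ≡ j
    same = lookup-injective (Unique.filter⁺ ordered? (Unique.cartesianProduct⁺ (Unique.allFin⁺ n) (Unique.allFin⁺ n))) i j
    ordered : ∀ i {a b} → List.lookup (pairs n) i ≡ (a , b) → a Fin.< b
    ordered i e = subst (λ (a , b) → a Fin.< b) e (pairs-ordered n i)
    cases : Matches (List.lookup (pairs n) i) u v → Matches (List.lookup (pairs n) j) u v → i ≡ j
    cases (inj₁ p) (inj₁ q) = same (trans p (≡.sym q))
    cases (inj₂ p) (inj₂ q) = same (trans p (≡.sym q))
    cases (inj₁ p) (inj₂ q) = contradiction (ordered j q) (<-asym (ordered i p))
    cases (inj₂ p) (inj₁ q) = contradiction (ordered j q) (<-asym (ordered i p))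

  -- An edge collapsed by `φ` has no coordinate and is dropped, which makes the definition total; an
  -- injective `φ` keeps distinct ends apart.
  coords : (Fin k → Fin n) → List (Fin k × Fin k) → List (Fin (length (pairs n)))
  coords φ [] = []
  coords φ ((u , v) ∷ es) with φ u Fin.≟ φ v
  ... | yes _  = coords φ es
  ... | no ne = proj₁ (locate ne) ∷ coords φ es

  coords-length : (φ : Fin k → Fin n) → ∀ es → length (coords φ es) ≤ length es
  coords-length φ [] = z≤n
  coords-length φ ((u , v) ∷ es) with φ u Fin.≟ φ v
  ... | yes _ = m≤n⇒m≤1+n (coords-length φ es)
  ... | no _ = s≤s (coords-length φ es)

  ∈-coords : (φ : Fin k → Fin n) → ∀ es {u v} → (u , v) ∈ es → (ne : φ u ≢ φ v) → proj₁ (locate ne) ∈ coords φ es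
  ∈-coords φ ((u , v) ∷ es) p ne with φ u Fin.≟ φ v
  ∈-coords φ ((u , v) ∷ es) (here refl) ne | yes e = contradiction e ne
  ∈-coords φ ((u , v) ∷ es) (there p) ne | yes e = ∈-coords φ es p ne
  ∈-coords φ ((u , v) ∷ es) (here refl) ne | no ne′ =
    here (index-unique _ _ (proj₁ (proj₂ (locate ne))) (proj₁ (proj₂ (locate ne′))))
  ∈-coords φ ((u , v) ∷ es) (there p) ne | no _ = there (∈-coords φ es p ne)

  coords-∈ : (φ : Fin k → Fin n) → ∀ es {i} → i ∈ coords φ es →
    ∃[ u ] ∃[ v ] ((u , v) ∈ es × Matches (List.lookup (pairs n) i) (φ u) (φ v))
  coords-∈ φ ((u , v) ∷ es) p with φ u Fin.≟ φ v
  coords-∈ φ ((u , v) ∷ es) (here refl) | no ne = u , v , here refl , proj₁ (proj₂ (locate ne))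
  coords-∈ φ ((u , v) ∷ es) (there p) | no ne with coords-∈ φ es p
  ... | a , b , q , m = a , b , there q , m
  coords-∈ φ ((u , v) ∷ es) p | yes _ with coords-∈ φ es p
  ... | a , b , q , m = a , b , there q , m

  InjectiveOn : (Fin k → Fin n) → Set
  InjectiveOn φ = ∀ u v → φ u ≡ φ v → u ≡ v

  injective? : (φ : Fin k → Fin n) → Dec (InjectiveOn φ)
  injective? φ = Fin.all? λ u → Fin.all? λ v → (φ u Fin.≟ φ v) →-dec (u Fin.≟ v)

  -- Maps are enumerated as vectors to obtain a finite list. It does not depend on the outcome and
  -- serves as the family `H` of the exchange.
  copies : List (Fin k × Fin k) → ∀ n → List (List (Fin (length (pairs n))))
  copies {k} es n = List.map (λ w → coords (lookup w) es) (filter (injective? ∘ lookup) (allVecs (allFin n) k))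

  copies-∈ : (es : List (Fin k × Fin k)) → ∀ {h} → h ∈ copies es n →
    ∃[ φ ] (InjectiveOn φ × h ≡ coords φ es)
  copies-∈ {k} {n} es p with ∈-map⁻ (λ w → coords (lookup w) es) p
  ... | w , q , e = lookup w , proj₂ (∈-filter⁻ (injective? ∘ lookup) {xs = allVecs (allFin n) k} q) , e

  copies-short : (es : List (Fin k × Fin k)) → ∀ n → All (λ h → length h ≤ length es) (copies es n)
  copies-short es n = All.tabulate λ p → let (φ , _ , e) = copies-∈ es p in
    subst (λ h → length h ≤ length es) (≡.sym e) (coords-length φ es)

  ∈-copies : (es : List (Fin k × Fin k)) (w : Vec (Fin n) k) → InjectiveOn (lookup w) → coords (lookup w) es ∈ copies es n
  ∈-copies {k} {n} es w inj = ∈-map⁺ (λ w → coords (lookup w) es)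
    (∈-filter⁺ (injective? ∘ lookup) (allVecs-complete ∈-allFin w) inj)

  bitGraph : Vec Bool (length (pairs n)) → Fin n → Fin n → Bool
  bitGraph b u v with u Fin.≟ v
  ... | yes _ = false
  ... | no ne = lookup b (proj₁ (locate ne))

  bitGraph-intro : (b : Vec Bool (length (pairs n))) → ∀ i {u v} → Matches (List.lookup (pairs n) i) u v →
    lookup b i ≡ true → bitGraph b u v ≡ true
  bitGraph-intro {n} b i {u} {v} mt e with u Fin.≟ v
  ... | yes refl = contradiction (pairs-ordered n i) (<-irrefl (cong Fin.toℕ (diag mt)))
    where
    diag : ∀ {e : Fin n × Fin n} {u} → Matches e u u → proj₁ e ≡ proj₂ e
    diag (inj₁ refl) = refl
    diag (inj₂ refl) = refl
  ... | no ne = trans (cong (lookup b) (index-unique _ i (proj₁ (proj₂ (locate ne))) mt)) e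

  bitGraph-elim : (b : Vec Bool (length (pairs n))) → ∀ i {u v} → Matches (List.lookup (pairs n) i) u v →
    bitGraph b u v ≡ true → lookup b i ≡ true
  bitGraph-elim b i {u} {v} mt e with u Fin.≟ v
  ... | no ne = trans (cong (lookup b) (index-unique i _ mt (proj₁ (proj₂ (locate ne))))) e

  -- The embedding given by joinedness is one of the enumerated injective maps once it is tabulated.
  -- Distinctness is vacuous because cells from bits carry no colour.
  uncoloured-hit : (T : Graph k) → ∀ {D} (sk : Skeleton T D) → ∀ m → 1 ≤ m → k + (3 * D + 7) * m ≤ n →
    (b : Vec Bool (length (pairs n))) → Neighbourhood.Joined (bitGraph {n} b) m →
    Any (Compatible {n} (Vec.map uncoloured b)) (copies (Skeleton.es sk) n)
  uncoloured-hit {n = n} T sk m 1≤m big b joined with Skeleton.embed sk (bitGraph {n} b) m 1≤m joined big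
  ... | φ , inj , edges = lose (∈-copies es w inj′) (All.tabulate present , All.tabulate λ {i} _ → All.tabulate λ _ → inj₂ λ c e → contradiction e (colourless i c))
    where
    open Skeleton sk
    w = tabulate φ
    w≡ : ∀ u → lookup w u ≡ φ u
    w≡ = lookup∘tabulate φ
    inj′ : InjectiveOn (lookup w)
    inj′ u v e = inj (trans (≡.sym (w≡ u)) (trans e (w≡ v)))
    wild≢absent : wild {n} ≢ absent
    wild≢absent ()
    present : ∀ {i} → i ∈ coords (lookup w) es → lookup (Vec.map uncoloured b) i ≢ absent
    present {i} p with coords-∈ (lookup w) es p
    ... | u , v , q , mt = subst (_≢ absent) (≡.sym (trans (lookup-map i uncoloured b) (cong uncoloured
            (bitGraph-elim {n} b i mt (trans (cong₂ (bitGraph {n} b) (w≡ u) (w≡ v)) (edges q)))))) wild≢absent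
    colourless : ∀ i c → lookup (Vec.map uncoloured b) i ≢ col c
    colourless i c e = no-colour (lookup b i) (trans (≡.sym (lookup-map i uncoloured b)) e)
      where
      no-colour : ∀ x → uncoloured x ≢ col c
      no-colour true ()
      no-colour false ()

  -- By compatibility equal colours come from the same coordinate, hence from the same pair of
  -- images, and injectivity of `φ` carries this back to the same edge of `T` up to orientation.
  hit-rainbow : (T : Graph k) → ∀ {D} (sk : Skeleton T D) (ω : Outcome n) →
    Any (Compatible (Vec.map cell ω)) (copies (Skeleton.es sk) n) → RainbowCopy T ω
  hit-rainbow {k = k} {n = n} T sk ω hit with find hit
  ... | h , h∈ , compat with copies-∈ (Skeleton.es sk) h∈
  ...   | φ , inj , refl = record
    { φ = φ
    ; φ-inj = λ {u} {v} → inj u v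
    ; col = λ u v a → proj₁ (colour u v a)
    ; isEdge = λ u v a → proj₁ (proj₂ (colour u v a))
    ; rainbow = λ u v u′ v′ a a′ e → rainbow u v u′ v′ (colour u v a) (colour u′ v′ a′) e
    }
    where
    open Skeleton sk
    Coloured : Fin k → Fin k → Set
    -- The coordinate travels with the colour, so that equal colours can be traced back to equal
    -- coordinates.
    Coloured u v = Σ (Fin n) λ c → edgeCol ω (φ u) (φ v) ≡ just c × (∃[ i ] (i ∈ coords φ es × lookup ω i ≡ just c ×
                     Matches (List.lookup (pairs n) i) (φ u) (φ v)))
    u≢v : ∀ u v → Adj T u v → φ u ≢ φ v
    u≢v u v a e with inj u v e
    ... | refl = contradiction (trans (≡.sym a) (irrefl T u)) λ ()
    oriented : ∀ u v → φ u ≢ φ v → (u , v) ∈ es → Coloured u v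
    oriented u v ne p = read (lookup ω i) refl
      where
      i = proj₁ (locate ne)
      i∈ = ∈-coords φ es p ne
      read : ∀ x → lookup ω i ≡ x → Coloured u v
      read nothing  e = contradiction (trans (lookup-map i cell ω) (cong cell e)) (All.lookup (proj₁ compat) i∈)
      read (just c) e = c , trans (proj₂ (proj₂ (locate ne)) ω) e , i , i∈ , e , proj₁ (proj₂ (locate ne))
    colour : ∀ u v → Adj T u v → Coloured u v
    colour u v a with complete u v a
    ... | inj₁ p = oriented u v (u≢v u v a) p
    ... | inj₂ p with oriented v u (u≢v u v a ∘ ≡.sym) p
    ...   | c , e , i , i∈ , e′ , mt = c , trans (findCol-sym (zip (pairs n) (toList ω)) (φ u) (φ v)) e , i , i∈ , e′ , swap mt
    rainbow : ∀ u v u′ v′ (x : Coloured u v) (y : Coloured u′ v′) → proj₁ x ≡ proj₁ y → (u ≡ u′ × v ≡ v′) ⊎ (u ≡ v′ × v ≡ u′)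
    rainbow u v u′ v′ (c , _ , i , i∈ , e , mt) (.c , _ , j , j∈ , e′ , mt′) refl
      with All.lookup (All.lookup (proj₂ compat) i∈) j∈
    ... | inj₂ distinct = contradiction (trans (lookup-map j cell ω) (cong cell e′)) (distinct c (trans (lookup-map i cell ω) (cong cell e)))
    ... | inj₁ refl = ends mt mt′
      where
      ends : Matches (List.lookup (pairs n) i) (φ u) (φ v) → Matches (List.lookup (pairs n) i) (φ u′) (φ v′) → (u ≡ u′ × v ≡ v′) ⊎ (u ≡ v′ × v ≡ u′)
      ends (inj₁ p) (inj₁ q) with trans (≡.sym p) q
      ... | r = inj₁ (inj u u′ (cong proj₁ r) , inj v v′ (cong proj₂ r))
      ends (inj₁ p) (inj₂ q) with trans (≡.sym p) q
      ... | r = inj₂ (inj u v′ (cong proj₁ r) , inj v u′ (cong proj₂ r))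
      ends (inj₂ p) (inj₁ q) with trans (≡.sym p) q
      ... | r = inj₂ (inj u v′ (cong proj₂ r) , inj v u′ (cong proj₁ r))
      ends (inj₂ p) (inj₂ q) with trans (≡.sym p) q
      ... | r = inj₁ (inj u u′ (cong proj₂ r) , inj v v′ (cong proj₁ r))

  -- Pairs of large vertex sets and the edges between them

  length-cartesianProductWith : ∀ {A B C : Set} (f : A → B → C) xs ys →
    length (List.cartesianProductWith f xs ys) ≡ length xs * length ys
  length-cartesianProductWith f [] ys = refl
  length-cartesianProductWith f (x ∷ xs) ys = trans (length-++ (List.map (f x) ys))
    (cong₂ _+_ (length-map (f x) ys) (length-cartesianProductWith f xs ys))

  -- Pairs are stored in increasing order, so either end may be the one in `A`.
  cross : Subset n → Subset n → Fin n × Fin n → Bool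
  cross A B (x , y) = (lookup A x ∧ lookup B y) ∨ (lookup A y ∧ lookup B x)

  crossing : Subset n → Subset n → Vec Bool (length (pairs n))
  crossing {n} A B = tabulate (λ i → cross A B (List.lookup (pairs n) i))

  length-filterᵇ-lookup : (f : A → Bool) (xs : List A) → length (filterᵇ f xs) ≡ count (f ∘ List.lookup xs)
  length-filterᵇ-lookup f [] = refl
  length-filterᵇ-lookup f (x ∷ xs) with f x
  ... | true  = cong suc (length-filterᵇ-lookup f xs)
  ... | false = length-filterᵇ-lookup f xs

  length-filterᵇ-tabulate : ∀ {n} (f : A → Bool) (g : Fin n → A) → length (filterᵇ f (List.tabulate g)) ≡ count (f ∘ g)
  length-filterᵇ-tabulate {n = zero} f g = refl
  length-filterᵇ-tabulate {n = suc n} f g with f (g zero)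
  ... | true  = cong suc (length-filterᵇ-tabulate f (g ∘ suc))
  ... | false = length-filterᵇ-tabulate f (g ∘ suc)

  Disjoint : Subset n → Subset n → Set
  Disjoint A B = ∀ v → lookup A v ≡ true → lookup B v ≡ false

  disjoint? : (A B : Subset n) → Dec (Disjoint A B)
  disjoint? A B = Fin.all? λ v → (lookup A v Data.Bool.≟ true) →-dec (lookup B v Data.Bool.≟ false)

  -- Disjointness makes the end in `A` recognisable: `orient` puts it in front and thereby maps the
  -- crossing pairs onto a list that contains A × B.
  crossing-size : (A B : Subset n) → Disjoint A B → size A * size B ≤ size (crossing A B)
  crossing-size {n} A B disjoint = begin
    size A * size B
      ≡⟨ cong₂ _*_ (length-filterᵇ-tabulate {n = n} (lookup A) id) (length-filterᵇ-tabulate {n = n} (lookup B) id) ⟨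
    length As * length Bs                            ≡⟨ length-cartesianProductWith _,_ As Bs ⟨
    length (cartesianProduct As Bs)
      ≤⟨ unique-⊆-length (Unique.cartesianProduct⁺ (filterᵇ-unique (lookup A) (Unique.allFin⁺ n))
          (filterᵇ-unique (lookup B) (Unique.allFin⁺ n))) hits ⟩
    length (List.map orient (filterᵇ (cross A B) (pairs n)))
      ≡⟨ length-map orient (filterᵇ (cross A B) (pairs n)) ⟩
    length (filterᵇ (cross A B) (pairs n))           ≡⟨ length-filterᵇ-lookup (cross A B) (pairs n) ⟩
    count (cross A B ∘ List.lookup (pairs n))
      ≡⟨ sum-cong-≗ (λ i → cong ι (lookup∘tabulate (λ i → cross A B (List.lookup (pairs n) i)) i)) ⟨
    size (crossing A B)                              ∎
    where
    open ℕ.≤-Reasoning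
    As = filterᵇ (lookup A) (allFin n)
    Bs = filterᵇ (lookup B) (allFin n)
    orient : Fin n × Fin n → Fin n × Fin n
    orient (x , y) = if lookup A x then (x , y) else (y , x)
    hits : ∀ {xy} → xy ∈ cartesianProduct As Bs → xy ∈ List.map orient (filterᵇ (cross A B) (pairs n))
    hits {x , y} p with ∈-cartesianProduct⁻ As Bs p
    ... | x∈ , y∈ = oriented (Fin.<-cmp x y)
      where
      Ax : lookup A x ≡ true
      Ax = proj₂ (filterᵇ-⊆ (lookup A) (allFin n) x∈)
      By : lookup B y ≡ true
      By = proj₂ (filterᵇ-⊆ (lookup B) (allFin n) y∈)
      Ay : lookup A y ≡ false
      Ay = ¬-not λ e → contradiction (trans (≡.sym By) (disjoint y e)) λ ()
      oriented : Relation.Binary.Definitions.Tri (x Fin.< y) (x ≡ y) (y Fin.< x) → (x , y) ∈ List.map orient (filterᵇ (cross A B) (pairs n))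
      oriented (tri< x<y _ _) = subst (_∈ List.map orient (filterᵇ (cross A B) (pairs n)))
        (cong (if_then (x , y) else (y , x)) Ax)
        (∈-map⁺ orient (∈-filterᵇ (cross A B) (pairs n) (∈-pairs x<y) (cong (_∨ (lookup A y ∧ lookup B x)) (cong₂ _∧_ Ax By))))
      oriented (tri≈ _ refl _) = contradiction (trans (≡.sym Ax) Ay) λ ()
      oriented (tri> _ _ y<x) = subst (_∈ List.map orient (filterᵇ (cross A B) (pairs n)))
        (cong (if_then (y , x) else (x , y)) Ay)
        (∈-map⁺ orient (∈-filterᵇ (cross A B) (pairs n) (∈-pairs y<x) (trans (∨-comm (lookup A y ∧ lookup B x) _) (cong (_∨ (lookup A y ∧ lookup B x)) (cong₂ _∧_ Ax By)))))

  -- Sizes are at least `m` rather than exactly `m`, so that a set and the vertices away from it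
  -- qualify untrimmed; there are still at most 4^n such pairs.
  Large : ℕ → Subset n × Subset n → Set
  Large m (A , B) = m ≤ size A × m ≤ size B × Disjoint A B

  large? : ∀ m → Decidable (Large {n} m)
  large? m (A , B) = (m ℕ.≤? size A) ×-dec ((m ℕ.≤? size B) ×-dec disjoint? A B)

  bools : List Bool
  bools = true ∷ false ∷ []

  ∈-bools : ∀ b → b ∈ bools
  ∈-bools true  = here refl
  ∈-bools false = there (here refl)

  largePairs : ∀ n → ℕ → List (Subset n × Subset n)
  largePairs n m = filter (large? m) (cartesianProduct (allVecs bools n) (allVecs bools n))

  -- If `m` vertices were away from a set `A` of size at least `m`, the two sets would form a large
  -- pair, and the edge that hits it would make an away vertex a neighbour of `A`.
  joined-of-hits : ∀ m (b : Vec Bool (length (pairs n))) →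
    (∀ A B → (A , B) ∈ largePairs n m → misses (crossing A B) b ≡ false) → Neighbourhood.Joined (bitGraph {n} b) m
  joined-of-hits {n} m b hits A m≤A = ℕ.≰⇒> λ m≤away → impossible (subst (m ≤_) (≡.sym sizeB) m≤away)
    where
    open Neighbourhood (bitGraph {n} b)
    B : Subset n
    B = tabulate (away A)
    B≡ : ∀ v → lookup B v ≡ away A v
    B≡ = lookup∘tabulate (away A)
    sizeB : size B ≡ count (away A)
    sizeB = sum-cong-≗ λ v → cong ι (B≡ v)
    disjoint : Disjoint A B
    disjoint v e = trans (B≡ v) (cong (λ a → not a ∧ not (N A v)) e)
    far : ∀ {x y} → lookup A x ≡ true → lookup B y ≡ true → bitGraph b x y ≢ true
    far {x} {y} p q e = contradiction (trans (≡.sym (∧-conicalʳ (not (lookup A y)) _ (trans (≡.sym (B≡ y)) q)))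
        (cong not (N-intro A p e))) λ ()
    impossible : ¬ (m ≤ size B)
    impossible m≤B with misses-no (crossing A B) b (hits A B (∈-filter⁺ (large? m) (∈-cartesianProduct⁺ (allVecs-complete ∈-bools A) (allVecs-complete ∈-bools B)) (m≤A , m≤B , disjoint)))
    ... | i , ci , bi = ends (trans (≡.sym (lookup∘tabulate _ i)) ci)
      where
      x = proj₁ (List.lookup (pairs n) i)
      y = proj₂ (List.lookup (pairs n) i)
      ends : cross A B (x , y) ≢ true
      ends c with lookup A x ∧ lookup B y in eq
      ... | true = far (∧-conicalˡ _ _ eq) (∧-conicalʳ (lookup A x) _ eq) (bitGraph-intro {n} b i (inj₁ refl) bi)
      ... | false = far (∧-conicalˡ _ _ c) (∧-conicalʳ (lookup A y) _ c) (bitGraph-intro {n} b i (inj₂ refl) bi)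

  length-allVecs : (xs : List A) → ∀ l → length (allVecs xs l) ≡ length xs ℕ.^ l
  length-allVecs xs zero    = refl
  length-allVecs xs (suc l) = trans (length-cartesianProductWith _∷_ xs (allVecs xs l))
      (cong (length xs *_) (length-allVecs xs l))

  length-largePairs : ∀ n m → length (largePairs n m) ≤ 2 ℕ.^ n * 2 ℕ.^ n
  length-largePairs n m = ≤-trans (length-filter (large? m) (cartesianProduct (allVecs bools n) (allVecs bools n)))
    (≤-reflexive (trans (length-cartesianProductWith _,_ (allVecs bools n) (allVecs bools n))
      (cong₂ _*_ (length-allVecs bools n) (length-allVecs bools n))))

-- Probability estimates

module Likelihood where

  open import Defs
  open import Data.Bool using (Bool; true)
  import Data.Bool as Bool
  open import Data.Bool.Properties using (¬-not)
  open import Data.Fin.Subset using (Subset)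
  open import Data.Integer using (+_)
  import Data.Integer as ℤ
  open import Data.List as List using (List; []; _∷_; length; filter)
  open import Data.List.Membership.Propositional using (_∈_; find; lose)
  open import Data.List.Membership.Propositional.Properties using (∈-filter⁻; ∈-map⁻)
  open import Data.List.Relation.Unary.All as All using (All; []; _∷_)
  open import Data.List.Relation.Unary.All.Properties using (all-filter)
  open import Data.List.Relation.Unary.Any as Any using (Any; here; there)
  open import Data.List.Relation.Unary.AllPairs using ([]; _∷_)
  open import Data.List.Relation.Unary.Unique.Propositional using (Unique)
  import Data.List.Relation.Unary.Unique.Propositional.Properties as Unique
  open import Data.Maybe using (just; nothing)
  open import Data.Maybe.Properties using (just-injective)
  open import Data.Nat as ℕ using (ℕ; zero; suc; z≤n; s≤s)
  import Data.Nat.DivMod as ℕ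
  import Data.Nat.Properties as ℕ
  import Data.Nat.Solver as ℕSolver
  open import Data.Product using (Σ; _×_; _,_; ∃-syntax; proj₁; proj₂)
  open import Data.Rational as ℚ using (ℚ; 0ℚ; 1ℚ; _+_; _*_; _-_; -_; _≤_; _<_; _/_; toℚᵘ; positive; mkℚ)
  open import Data.Rational.Properties
  import Data.Rational.Unnormalised as ℚᵘ
  import Data.Rational.Unnormalised.Properties as ℚᵘ
  open import Data.Rational.Solver using (module +-*-Solver)
  open import Data.Vec as Vec using (Vec)
  open import Function using (_∘_; const)
  open import Relation.Binary.PropositionalEquality hiding (sym)
  import Relation.Binary.PropositionalEquality as ≡
  open import Relation.Nullary using (Dec; yes; no)
  open import Relation.Nullary.Decidable using (⌊_⌋)
  open import Algebra.Bundles using (CommutativeRing)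
  open import Algebra.Properties.CommutativeSemiring.Exp (CommutativeRing.commutativeSemiring +-*-commutativeRing) using (_^_; ^-distrib-*; ^-assocʳ; ^-homo-*)

  open Embedding
  open TreeEmbedding
  open Exchanging
  open Coordinates

  private variable X : Set

  -- Turns `avg` into summation over a list, here over the large pairs in the union bound.
  counting : List X → Dist X
  counting = weighted (const 1ℚ)

  counting-upper : (f : X → ℚ) (c : ℚ) → ∀ xs → (∀ x → x ∈ xs → f x ≤ c) → avg (counting xs) f ≤ fromℕ (length xs) * c
  counting-upper f c [] f≤c = ≤-reflexive (≡.sym (*-zeroˡ c))
  counting-upper f c (x ∷ xs) f≤c = begin
    1ℚ * f x + avg (counting xs) f
      ≤⟨ +-mono-≤ (*-monoˡ 0≤1 (f≤c x (here refl))) (counting-upper f c xs λ y → f≤c y ∘ there) ⟩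
    1ℚ * c + fromℕ (length xs) * c       ≡⟨ *-distribʳ-+ c 1ℚ (fromℕ (length xs)) ⟨
    (1ℚ + fromℕ (length xs)) * c         ≡⟨ cong (_* c) (fromℕ-+ 1 (length xs)) ⟨
    fromℕ (suc (length xs)) * c          ∎
    where open ≤-Reasoning

  avg-nonNeg : {μ : Dist X} → NonNeg μ → {f : X → ℚ} → (∀ x → 0ℚ ≤ f x) → 0ℚ ≤ avg μ f
  avg-nonNeg {μ = μ} nn 0≤f = ≤-trans (≤-reflexive (≡.sym (avg-zero μ))) (avg-mono nn 0≤f)

  counting-member : (f : X → ℚ) → (∀ x → 0ℚ ≤ f x) → ∀ {x xs} → x ∈ xs → f x ≤ avg (counting xs) f
  counting-member f 0≤f {x} {_ ∷ xs} (here refl) = begin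
    f x                             ≡⟨ trans (+-identityʳ _) (*-identityˡ (f x)) ⟨
    1ℚ * f x + 0ℚ
      ≤⟨ +-monoʳ-≤ (1ℚ * f x) (avg-nonNeg (weighted-NonNeg (λ _ → 0≤1) xs) 0≤f) ⟩
    1ℚ * f x + avg (counting xs) f  ∎
    where open ≤-Reasoning
  counting-member f 0≤f {x} {y ∷ xs} (there p) = begin
    f x                             ≤⟨ counting-member f 0≤f p ⟩
    avg (counting xs) f             ≡⟨ +-identityˡ _ ⟨
    0ℚ + avg (counting xs) f        ≤⟨ +-monoˡ-≤ _ (0≤* 0≤1 (0≤f y)) ⟩
    1ℚ * f y + avg (counting xs) f  ∎
    where open ≤-Reasoning

  0≤^ : ∀ {x} → 0ℚ ≤ x → ∀ a → 0ℚ ≤ x ^ a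
  0≤^ 0≤x zero    = 0≤1
  0≤^ 0≤x (suc a) = 0≤* 0≤x (0≤^ 0≤x a)

  ^≤1 : ∀ {x} → 0ℚ ≤ x → x ≤ 1ℚ → ∀ a → x ^ a ≤ 1ℚ
  ^≤1 0≤x x≤1 zero = ≤-refl
  ^≤1 {x} 0≤x x≤1 (suc a) = ≤-trans (*-monoˡ 0≤x (^≤1 0≤x x≤1 a)) (≤-trans (≤-reflexive (*-identityʳ x)) x≤1)

  ^-antitone : ∀ {x} → 0ℚ ≤ x → x ≤ 1ℚ → ∀ {a b} → a ℕ.≤ b → x ^ b ≤ x ^ a
  ^-antitone {x} 0≤x x≤1 {a} {b} a≤b = begin
    x ^ b                       ≡⟨ cong (x ^_) (ℕ.m+[n∸m]≡n a≤b) ⟨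
    x ^ (a ℕ.+ (b ℕ.∸ a))       ≡⟨ ^-homo-* x a (b ℕ.∸ a) ⟩
    x ^ a * x ^ (b ℕ.∸ a)       ≤⟨ *-monoˡ (0≤^ 0≤x a) (^≤1 0≤x x≤1 (b ℕ.∸ a)) ⟩
    x ^ a * 1ℚ                  ≡⟨ *-identityʳ (x ^ a) ⟩
    x ^ a                       ∎
    where open ≤-Reasoning

  fromℕ-^ : ∀ b a → fromℕ (b ℕ.^ a) ≡ fromℕ b ^ a
  fromℕ-^ b zero    = refl
  fromℕ-^ b (suc a) = trans (fromℕ-* b (b ℕ.^ a)) (cong (fromℕ b *_) (fromℕ-^ b a))

  -- Rational substitute for the exponential bound on (1 - q)^a. In the induction, (1 - q)(1 + (a +
  -- 1)q) = 1 + aq - (a + 1)q² ≤ 1 + aq.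
  bernoulli : ∀ {q} → 0ℚ ≤ q → q ≤ 1ℚ → ∀ a → (1ℚ - q) ^ a * (1ℚ + fromℕ a * q) ≤ 1ℚ
  bernoulli {q} 0≤q q≤1 zero = ≤-reflexive (solve 1 (λ q → con 1ℚ :* (con 1ℚ :+ con 0ℚ :* q) := con 1ℚ) refl q)
    where open +-*-Solver
  bernoulli {q} 0≤q q≤1 (suc a) = begin
    (1ℚ - q) * y * (1ℚ + fromℕ (suc a) * q)
      ≡⟨ cong (λ z → (1ℚ - q) * y * (1ℚ + z * q)) (fromℕ-+ 1 a) ⟩
    (1ℚ - q) * y * (1ℚ + (1ℚ + A) * q)
      ≡⟨ solve 3 (λ q y A → (con 1ℚ :+ :- q) :* y :* (con 1ℚ :+ (con 1ℚ :+ A) :* q) := y :*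
          (con 1ℚ :+ A :* q :+ :- ((con 1ℚ :+ A) :* (q :* q)))) refl q y A ⟩
    y * (1ℚ + A * q - (1ℚ + A) * (q * q))
      ≤⟨ *-monoˡ (0≤^ (0≤1- q≤1) a) (≤-trans (+-monoʳ-≤ (1ℚ + A * q)
          (neg-antimono-≤ (0≤* (0≤+ 0≤1 (0≤fromℕ a)) (0≤* 0≤q 0≤q)))) (≤-reflexive (+-identityʳ (1ℚ + A * q)))) ⟩
    y * (1ℚ + A * q)                                      ≤⟨ bernoulli 0≤q q≤1 a ⟩
    1ℚ                                                    ∎
    where
    open ≤-Reasoning
    open +-*-Solver
    y = (1ℚ - q) ^ a
    A = fromℕ a

  module _ {k D : ℕ} (T : Graph k) (sk : Skeleton T D) (n m : ℕ) (1≤m : 1 ℕ.≤ m) (big : k ℕ.+ (3 ℕ.* D ℕ.+ 7) ℕ.* m ℕ.≤ n)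
    (q : ℚ) (0≤q : 0ℚ ≤ q) (q≤1 : q ≤ 1ℚ) where

    private
      l = length (pairs n)
      H = copies (Skeleton.es sk) n
      hits : Vec Bool l → ℚ
      hits b = ind ⌊ hit? {n} H (Vec.map uncoloured b) ⌋
      miss : Subset n × Subset n → Vec Bool l → ℚ
      miss AB b = ind (misses (crossing (proj₁ AB) (proj₂ AB)) b)

    -- The union bound before averaging: either some large pair has no edge and contributes 1 to the
    -- sum, or the graph is joined and contains a copy.
    uncoloured-pointwise : ∀ b → 1ℚ ≤ hits b + avg (counting (largePairs n m)) (λ AB → miss AB b)
    uncoloured-pointwise b with Any.any? (λ AB → misses (crossing (proj₁ AB) (proj₂ AB)) b Bool.≟ true) (largePairs n m)
    ... | yes bad = begin
      1ℚ                                                       ≡⟨ cong ind (proj₂ (proj₂ (find bad))) ⟨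
      miss (proj₁ (find bad)) b
        ≤⟨ counting-member (λ AB → miss AB b) (λ AB → 0≤ind (misses (crossing (proj₁ AB) (proj₂ AB)) b))
            (proj₁ (proj₂ (find bad))) ⟩
      avg (counting (largePairs n m)) (λ AB → miss AB b)       ≡⟨ +-identityˡ _ ⟨
      0ℚ + avg (counting (largePairs n m)) (λ AB → miss AB b)
        ≤⟨ +-monoˡ-≤ _ (0≤ind ⌊ hit? {n} H (Vec.map uncoloured b) ⌋) ⟩
      hits b + avg (counting (largePairs n m)) (λ AB → miss AB b) ∎
      where open ≤-Reasoning
    ... | no good = begin
      1ℚ              ≡⟨ ind-yes (hit? {n} H (Vec.map uncoloured b)) (uncoloured-hit T sk m 1≤m big b
                           (joined-of-hits {n} m b λ A B p → ¬-not λ e → good (lose p e))) ⟨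
      hits b          ≡⟨ +-identityʳ _ ⟨
      hits b + 0ℚ
        ≤⟨ +-monoʳ-≤ (hits b) (avg-nonNeg (weighted-NonNeg (λ _ → 0≤1) (largePairs n m))
            (λ AB → 0≤ind (misses (crossing (proj₁ AB) (proj₂ AB)) b))) ⟩
      hits b + avg (counting (largePairs n m)) (λ AB → miss AB b) ∎
      where open ≤-Reasoning

    uncoloured-likely : 1ℚ ≤ E (bern q) l hits + fromℕ (2 ℕ.^ n ℕ.* 2 ℕ.^ n) * (1ℚ - q) ^ (m ℕ.* m)
    uncoloured-likely = begin
      1ℚ                                                         ≡⟨ E-one (bern q) (bern-total q) l ⟨
      E (bern q) l (const 1ℚ)
        ≤⟨ E-mono (bern-NonNeg 0≤q q≤1) l uncoloured-pointwise ⟩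
      E (bern q) l (λ b → hits b + avg (counting P) (λ AB → miss AB b)) ≡⟨ E-+ (bern q) l hits _ ⟩
      E (bern q) l hits + E (bern q) l (λ b → avg (counting P) (λ AB → miss AB b))
        ≡⟨ cong (λ z → E (bern q) l hits + z) (avg-E-swap (counting P) (bern q) l miss) ⟨
      E (bern q) l hits + avg (counting P) (λ AB → E (bern q) l (miss AB))
        ≤⟨ +-monoʳ-≤ (E (bern q) l hits) (counting-upper _ ((1ℚ - q) ^ (m ℕ.* m)) P rare) ⟩
      E (bern q) l hits + fromℕ (length P) * (1ℚ - q) ^ (m ℕ.* m)
        ≤⟨ +-monoʳ-≤ (E (bern q) l hits) (*-monoʳ (0≤^ (0≤1- q≤1) (m ℕ.* m)) (fromℕ-mono (length-largePairs n m))) ⟩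
      E (bern q) l hits + fromℕ (2 ℕ.^ n ℕ.* 2 ℕ.^ n) * (1ℚ - q) ^ (m ℕ.* m) ∎
      where
      open ≤-Reasoning
      P = largePairs n m
      rare : ∀ AB → AB ∈ P → E (bern q) l (miss AB) ≤ (1ℚ - q) ^ (m ℕ.* m)
      rare (A , B) p with proj₂ (∈-filter⁻ (large? m) {xs = List.cartesianProduct (allVecs bools n) (allVecs bools n)} p)
      ... | m≤A , m≤B , disjoint = ≤-trans (≤-reflexive (E-misses q l (crossing A B)))
              (^-antitone (0≤1- q≤1) (1-≤1 0≤q) (ℕ.≤-trans (ℕ.*-mono-≤ m≤A m≤B) (crossing-size A B disjoint)))

  -- The number 16 ^ s absorbs the 4 ^ n pairs of vertex sets, as n ≤ 2sm.
  rare-bound : ∀ s t (n m : ℕ) .{{_ : ℕ.NonZero s}} .{{_ : ℕ.NonZero t}} (p q : ℚ) → 0ℚ ≤ p → 0ℚ ≤ q → q ≤ 1ℚ → fromℕ t * q ≡ p →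
    n ℕ.≤ (s ℕ.+ s) ℕ.* m → fromℕ ((s ℕ.+ s) ℕ.* t ℕ.* (2 ℕ.* 16 ℕ.^ s)) ≤ fromℕ n * p →
    fromℕ (2 ℕ.^ m) * (fromℕ (2 ℕ.^ n ℕ.* 2 ℕ.^ n) * (1ℚ - q) ^ (m ℕ.* m)) ≤ 1ℚ
  rare-bound s t n m p q 0≤p 0≤q q≤1 tq≡p n≤ dense = begin
    fromℕ (2 ℕ.^ m) * (fromℕ (2 ℕ.^ n ℕ.* 2 ℕ.^ n) * (1ℚ - q) ^ (m ℕ.* m))
      ≤⟨ *-monoˡ (0≤fromℕ (2 ℕ.^ m)) (*-monoʳ (0≤^ (0≤1- q≤1) (m ℕ.* m)) (fromℕ-mono sets)) ⟩
    fromℕ (2 ℕ.^ m) * (fromℕ ((16 ℕ.^ s) ℕ.^ m) * (1ℚ - q) ^ (m ℕ.* m))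
      ≡⟨ cong₂ (λ a b → a * (b * (1ℚ - q) ^ (m ℕ.* m))) (fromℕ-^ 2 m) (fromℕ-^ (16 ℕ.^ s) m) ⟩
    fromℕ 2 ^ m * (fromℕ (16 ℕ.^ s) ^ m * (1ℚ - q) ^ (m ℕ.* m))
      ≡⟨ cong (λ z → fromℕ 2 ^ m * (fromℕ (16 ℕ.^ s) ^ m * z)) (^-assocʳ (1ℚ - q) m m) ⟨
    fromℕ 2 ^ m * (fromℕ (16 ℕ.^ s) ^ m * x ^ m)
      ≡⟨ cong (fromℕ 2 ^ m *_) (^-distrib-* (fromℕ (16 ℕ.^ s)) x m) ⟨
    fromℕ 2 ^ m * (fromℕ (16 ℕ.^ s) * x) ^ m ≡⟨ ^-distrib-* (fromℕ 2) (fromℕ (16 ℕ.^ s) * x) m ⟨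
    (fromℕ 2 * (fromℕ (16 ℕ.^ s) * x)) ^ m ≤⟨ ^≤1 (0≤* (0≤fromℕ 2) (0≤* (0≤fromℕ (16 ℕ.^ s)) 0≤x)) small m ⟩
    1ℚ ∎
    where
    open ≤-Reasoning
    x = (1ℚ - q) ^ m
    0≤x : 0ℚ ≤ x
    0≤x = 0≤^ (0≤1- q≤1) m
    sets : 2 ℕ.^ n ℕ.* 2 ℕ.^ n ℕ.≤ (16 ℕ.^ s) ℕ.^ m
    sets = ℕ.≤-trans (ℕ.≤-reflexive (≡.sym (ℕ.^-distribˡ-+-* 2 n n))) (ℕ.≤-trans (ℕ.^-monoʳ-≤ 2 (ℕ.+-mono-≤ n≤ n≤))
      (ℕ.≤-reflexive (trans (cong (2 ℕ.^_) (ℕS.solve 2 (λ s m → (s ℕS.:+ s) ℕS.:* m ℕS.:+ (s ℕS.:+ s) ℕS.:* m ℕS.:= ℕS.con 4 ℕS.:* (s ℕS.:* m)) refl s m))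
        (trans (≡.sym (ℕ.^-*-assoc 2 4 (s ℕ.* m))) (≡.sym (ℕ.^-*-assoc 16 s m))))))
      where module ℕS = ℕSolver.+-*-Solver
    C = (s ℕ.+ s) ℕ.* t
    b = 2 ℕ.* 16 ℕ.^ s
    instance
      C≢0 : ℕ.NonZero C
      C≢0 = ℕ.m*n≢0 (s ℕ.+ s) t {{ℕ.>-nonZero (ℕ.≤-trans (ℕ.>-nonZero⁻¹ s) (ℕ.m≤m+n s s))}}
    C-pos : ℚ.Positive (fromℕ C)
    C-pos = normalize-pos C 1
    -- As p = tq and n ≤ 2sm, np is at most C · mq with C = 2st. This is why the density threshold
    -- carries the factor `C`: cancelling it leaves 2 · 16^s ≤ mq.
    scaled : fromℕ C * fromℕ b ≤ fromℕ C * (fromℕ m * q)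
    scaled = begin
      fromℕ C * fromℕ b ≡⟨ fromℕ-* C b ⟨
      fromℕ (C ℕ.* b) ≤⟨ dense ⟩
      fromℕ n * p ≤⟨ *-monoʳ 0≤p (fromℕ-mono n≤) ⟩
      fromℕ ((s ℕ.+ s) ℕ.* m) * p ≡⟨ cong₂ _*_ (fromℕ-* (s ℕ.+ s) m) (≡.sym tq≡p) ⟩
      fromℕ (s ℕ.+ s) * fromℕ m * (fromℕ t * q)
        ≡⟨ solve 4 (λ a b c d → a :* b :* (c :* d) := a :* c :* (b :* d)) refl (fromℕ (s ℕ.+ s)) (fromℕ m) (fromℕ t) q ⟩
      fromℕ (s ℕ.+ s) * fromℕ t * (fromℕ m * q) ≡⟨ cong (_* (fromℕ m * q)) (fromℕ-* (s ℕ.+ s) t) ⟨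
      fromℕ C * (fromℕ m * q) ∎
      where open +-*-Solver
    b≤mq : fromℕ b ≤ fromℕ m * q
    b≤mq = *-cancelˡ-≤-pos (fromℕ C) {{C-pos}} scaled
    -- One factor (1 - q)^m out of the `m` in (1 - q)^(m²) pays for 16^s and for a further 2; the
    -- latter becomes the gain 2^m.
    small : fromℕ 2 * (fromℕ (16 ℕ.^ s) * x) ≤ 1ℚ
    small = begin
      fromℕ 2 * (fromℕ (16 ℕ.^ s) * x)
        ≡⟨ trans (≡.sym (*-assoc (fromℕ 2) (fromℕ (16 ℕ.^ s)) x)) (cong (_* x) (≡.sym (fromℕ-* 2 (16 ℕ.^ s)))) ⟩
      fromℕ b * x ≡⟨ *-comm (fromℕ b) x ⟩
      x * fromℕ b ≤⟨ *-monoˡ 0≤x b≤mq ⟩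
      x * (fromℕ m * q) ≡⟨ cong (x *_) (+-identityˡ (fromℕ m * q)) ⟨
      x * (0ℚ + fromℕ m * q) ≤⟨ *-monoˡ 0≤x (+-monoˡ-≤ (fromℕ m * q) 0≤1) ⟩
      x * (1ℚ + fromℕ m * q) ≤⟨ bernoulli 0≤q q≤1 m ⟩
      1ℚ ∎

  archimedean : ∀ x → 0ℚ < x → ∃[ d ] (ℕ.NonZero d × 1ℚ ≤ fromℕ d * x)
  archimedean x 0<x = from x (positive 0<x)
    where
    from : ∀ x → ℚ.Positive x → ∃[ d ] (ℕ.NonZero d × 1ℚ ≤ fromℕ d * x)
    -- The denominator of `x` suffices, since the numerator is at least 1.
    from x@(mkℚ (+ suc a) d _) _ = suc d , _ , toℚᵘ-cancel-≤ (begin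
      ℚᵘ.1ℚᵘ
        ≤⟨ ℚᵘ.*≤* (ℤ.+≤+ (ℕ.≤-trans (ℕ.≤-reflexive (trans (ℕ.*-identityˡ _) (ℕ.*-identityˡ (suc d))))
            (ℕ.≤-trans (ℕ.m≤m*n (suc d) (suc a)) (ℕ.≤-reflexive (≡.sym (ℕ.*-identityʳ _)))))) ⟩
      ℚᵘ.mkℚᵘ (+ suc d) 0 ℚᵘ.* toℚᵘ x ≃⟨ ℚᵘ.*-congʳ (toℚᵘ-fromℚᵘ (ℚᵘ.mkℚᵘ (+ suc d) 0)) ⟨
      toℚᵘ (fromℕ (suc d)) ℚᵘ.* toℚᵘ x ≃⟨ toℚᵘ-homo-* (fromℕ (suc d)) x ⟨
      toℚᵘ (fromℕ (suc d) * x) ∎)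
      where open ℚᵘ.≤-Reasoning

  allMaybe-unique : ∀ n → Unique (allMaybe n)
  allMaybe-unique n = All.tabulate nothing∉ ∷ Unique.map⁺ just-injective (Unique.allFin⁺ n)
    where
    nothing∉ : ∀ {x} → x ∈ List.map just (List.allFin n) → nothing ≢ x
    nothing∉ p refl with ∈-map⁻ just p
    ... | _ , _ , ()

  n≤2^n : ∀ n → n ℕ.≤ 2 ℕ.^ n
  n≤2^n zero    = z≤n
  n≤2^n (suc n) = ℕ.≤-trans (ℕ.+-mono-≤ (ℕ.m^n>0 2 n) (n≤2^n n))
      (ℕ.≤-reflexive (cong (2 ℕ.^ n ℕ.+_) (≡.sym (ℕ.+-identityʳ _))))

  -- The size hypothesis in integers and without subtraction; both the count of free colours and the
  -- room for the embedding start from this form.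
  proportion : ∀ {ε} t k n → 1ℚ ≤ fromℕ t * ε → fromℕ k ≤ (1ℚ - ε) * fromℕ n → t ℕ.* k ℕ.+ n ℕ.≤ t ℕ.* n
  proportion {ε} t k n tε≥1 k≤ = fromℕ-cancel (begin
    fromℕ (t ℕ.* k ℕ.+ n)
      ≡⟨ trans (fromℕ-+ (t ℕ.* k) n) (cong (_+ fromℕ n) (fromℕ-* t k)) ⟩
    fromℕ t * fromℕ k + fromℕ n
      ≤⟨ +-mono-≤ (*-monoˡ (0≤fromℕ t) k≤) (≤-trans (≤-reflexive (≡.sym (*-identityˡ (fromℕ n))))
          (*-monoʳ (0≤fromℕ n) tε≥1)) ⟩
    fromℕ t * ((1ℚ - ε) * fromℕ n) + fromℕ t * ε * fromℕ n
      ≡⟨ solve 3 (λ t e n → t :* ((con 1ℚ :+ :- e) :* n) :+ t :* e :* n := t :* n) refl (fromℕ t) ε (fromℕ n) ⟩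
    fromℕ t * fromℕ n                                       ≡⟨ fromℕ-* t n ⟨
    fromℕ (t ℕ.* n)                                         ∎)
    where
    open ≤-Reasoning
    open +-*-Solver

  -- A copy with at most `k` edges leaves n - k colours free, at least a fraction 1 / t of all of
  -- them, so thinning by `t` meets the condition of the exchange.
  thinning : ∀ {p q} t k n .{{_ : ℕ.NonZero n}} → 0ℚ ≤ q → fromℕ t * q ≡ p → t ℕ.* k ℕ.+ n ℕ.≤ t ℕ.* n →
    q ≤ p * (+ 1 / n) * fromℕ (n ℕ.∸ k)
  thinning {p} {q} t k n 0≤q tq≡p tk+n≤tn = begin
    q                                     ≡⟨ *-identityʳ q ⟨
    q * 1ℚ                                ≡⟨ cong (q *_) (fromℕ-recip n) ⟨
    q * (fromℕ n * r)
      ≤⟨ *-monoˡ 0≤q (*-monoʳ (nonNegative⁻¹ r {{normalize-nonNeg 1 n}}) (fromℕ-mono n≤)) ⟩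
    q * (fromℕ (t ℕ.* (n ℕ.∸ k)) * r)     ≡⟨ cong (λ z → q * (z * r)) (fromℕ-* t (n ℕ.∸ k)) ⟩
    q * (fromℕ t * fromℕ (n ℕ.∸ k) * r)
      ≡⟨ solve 4 (λ q t a r → q :* (t :* a :* r) := t :* q :* r :* a) refl q (fromℕ t) (fromℕ (n ℕ.∸ k)) r ⟩
    fromℕ t * q * r * fromℕ (n ℕ.∸ k)     ≡⟨ cong (λ z → z * r * fromℕ (n ℕ.∸ k)) tq≡p ⟩
    p * r * fromℕ (n ℕ.∸ k)               ∎
    where
    open ≤-Reasoning
    open +-*-Solver
    r = + 1 / n
    n≤ : n ℕ.≤ t ℕ.* (n ℕ.∸ k)
    n≤ = ℕ.≤-trans (ℕ.m+n≤o⇒m≤o∸n n (subst (ℕ._≤ t ℕ.* n) (ℕ.+-comm (t ℕ.* k) n) tk+n≤tn))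
        (ℕ.≤-reflexive (≡.sym (ℕ.*-distribˡ-∸ t n k)))

  -- Here `m` is n / s rounded down. The remainder is below s ≤ sm, so rounding costs at most a
  -- factor 2.
  blocks : ∀ s .{{_ : ℕ.NonZero s}} c n → s ℕ.* suc c ℕ.≤ n →
    ∃[ m ] (suc c ℕ.≤ m × s ℕ.* m ℕ.≤ n × n ℕ.≤ (s ℕ.+ s) ℕ.* m)
  blocks s c n large = m , c<m , sm≤n , (begin
    n                        ≡⟨ ℕ.m≡m%n+[m/n]*n n s ⟩
    n ℕ.% s ℕ.+ m ℕ.* s
      ≤⟨ ℕ.+-mono-≤ (ℕ.≤-trans (ℕ.<⇒≤ (ℕ.m%n<n n s)) (ℕ.m≤m*n s m {{ℕ.>-nonZero (ℕ.≤-trans (s≤s z≤n) c<m)}}))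
          (ℕ.≤-reflexive (ℕ.*-comm m s)) ⟩
    s ℕ.* m ℕ.+ s ℕ.* m      ≡⟨ ℕ.*-distribʳ-+ m s s ⟨
    (s ℕ.+ s) ℕ.* m          ∎)
    where
    open ℕ.≤-Reasoning
    m = n ℕ./ s
    c<m : suc c ℕ.≤ m
    c<m = ℕ.≤-trans (ℕ.≤-reflexive (≡.sym (trans (cong (ℕ._/ s) (ℕ.*-comm s (suc c))) (ℕ.m*n/n≡m (suc c) s))))
        (ℕ./-monoˡ-≤ s large)
    sm≤n : s ℕ.* m ℕ.≤ n
    sm≤n = ℕ.≤-trans (ℕ.≤-reflexive (ℕ.*-comm s m)) (ℕ.m/n*n≤m n s)

  -- Multiplied by `t`, the waste K · m becomes K · t · m ≤ n, exactly the slack that the tree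
  -- leaves.
  embedding-room : ∀ K t .{{_ : ℕ.NonZero t}} k m n → t ℕ.* k ℕ.+ n ℕ.≤ t ℕ.* n → K ℕ.* t ℕ.* m ℕ.≤ n → k ℕ.+ K ℕ.* m ℕ.≤ n
  embedding-room K t k m n tk+n≤tn Ktm≤n = ℕ.*-cancelˡ-≤ t (begin
    t ℕ.* (k ℕ.+ K ℕ.* m)
      ≡⟨ solve 4 (λ t k K m → t :* (k :+ K :* m) := t :* k :+ K :* t :* m) refl t k K m ⟩
    t ℕ.* k ℕ.+ K ℕ.* t ℕ.* m       ≤⟨ ℕ.+-monoʳ-≤ (t ℕ.* k) Ktm≤n ⟩
    t ℕ.* k ℕ.+ n                   ≤⟨ tk+n≤tn ⟩
    t ℕ.* n                         ∎)
    where
    open ℕ.≤-Reasoning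
    open ℕSolver.+-*-Solver

  module _ {k d : ℕ} (T : Graph k) (sk : Skeleton T d) (n m s t c : ℕ)
    .{{_ : ℕ.NonZero n}} .{{_ : ℕ.NonZero s}} .{{_ : ℕ.NonZero t}} .{{_ : ℕ.NonZero c}}
    (p δ : ℚ) (0≤p : 0ℚ ≤ p) (p≤1 : p ≤ 1ℚ) (cδ≥1 : 1ℚ ≤ fromℕ c * δ) (c<m : suc c ℕ.≤ m)
    (n≤2sm : n ℕ.≤ (s ℕ.+ s) ℕ.* m) (dense : fromℕ ((s ℕ.+ s) ℕ.* t ℕ.* (2 ℕ.* 16 ℕ.^ s)) ≤ fromℕ n * p)
    (tk+n≤tn : t ℕ.* k ℕ.+ n ℕ.≤ t ℕ.* n) (room : k ℕ.+ (3 ℕ.* d ℕ.+ 7) ℕ.* m ℕ.≤ n) where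

    private
      H = copies (Skeleton.es sk) n
      hits? : (ω : Outcome n) → Dec (Any (Compatible {n} (Vec.map cell ω)) H)
      hits? ω = hit? {n} H (Vec.map cell ω)
      q = p * (+ 1 / t)
      tq≡p : fromℕ t * q ≡ p
      tq≡p = trans (solve 3 (λ t p r → t :* (p :* r) := p :* (t :* r)) refl (fromℕ t) p (+ 1 / t))
               (trans (cong (p *_) (fromℕ-recip t)) (*-identityʳ p))
        where open +-*-Solver
      0≤q : 0ℚ ≤ q
      0≤q = 0≤* 0≤p (nonNegative⁻¹ (+ 1 / t) {{normalize-nonNeg 1 t}})
      q≤1 : q ≤ 1ℚ
      q≤1 = begin
        q              ≡⟨ *-identityˡ q ⟨
        fromℕ 1 * q    ≤⟨ *-monoʳ 0≤q (fromℕ-mono (ℕ.>-nonZero⁻¹ t)) ⟩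
        fromℕ t * q    ≡⟨ tq≡p ⟩
        p              ≤⟨ p≤1 ⟩
        1ℚ             ∎
        where open ≤-Reasoning
      uncolouredP F : ℚ
      uncolouredP = E (bern q) (length (pairs n)) (λ b → ind ⌊ hit? {n} H (Vec.map uncoloured b) ⌋)
      F = fromℕ (2 ℕ.^ n ℕ.* 2 ℕ.^ n) * (1ℚ - q) ^ (m ℕ.* m)
      F≤δ : F ≤ δ
      -- The failure probability is at most 2^(-m), and c < m ≤ 2^m turns this into at most 1 / c ≤
      -- δ.
      F≤δ = *-cancelˡ-≤-pos (fromℕ c) {{normalize-pos c 1}} (begin
        fromℕ c * F
          ≤⟨ *-monoʳ (0≤* (0≤fromℕ (2 ℕ.^ n ℕ.* 2 ℕ.^ n)) (0≤^ (0≤1- q≤1) (m ℕ.* m)))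
              (fromℕ-mono (ℕ.≤-trans (ℕ.<⇒≤ c<m) (n≤2^n m))) ⟩
        fromℕ (2 ℕ.^ m) * F    ≤⟨ rare-bound s t n m p q 0≤p 0≤q q≤1 tq≡p n≤2sm dense ⟩
        1ℚ                     ≤⟨ cδ≥1 ⟩
        fromℕ c * δ            ∎)
        where open ≤-Reasoning
      rainbow-heavy : 1ℚ - δ ≤ E (outcomeDist n p) (length (pairs n)) (λ ω → ind ⌊ hits? ω ⌋)
      rainbow-heavy = begin
        1ℚ - δ
          ≤⟨ +-mono-≤ (uncoloured-likely T sk n m (ℕ.≤-trans (s≤s z≤n) c<m) room q 0≤q q≤1) (neg-antimono-≤ F≤δ) ⟩
        uncolouredP + F - F  ≡⟨ solve 2 (λ a b → a :+ b :+ :- b := a) refl uncolouredP F ⟩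
        uncolouredP
          ≤⟨ coloured-exchange n p q 0≤p p≤1 0≤q q≤1 H k short (thinning t k n 0≤q tq≡p tk+n≤tn) ⟩
        E (outcomeDist n p) (length (pairs n)) (λ ω → ind ⌊ hits? ω ⌋) ∎
        where
        open ≤-Reasoning
        open +-*-Solver
        short : All (λ h → length h ℕ.≤ k) H
        short = All.map (λ le → ℕ.≤-trans le (Skeleton.short sk)) (copies-short (Skeleton.es sk) n)

    -- The list is cut out by the decidable event of a hit. Every hit yields a rainbow copy, which
    -- is all that a lower bound on the weight requires.
    rainbow-likely : Σ (List (Outcome n)) λ L → Unique L × All (RainbowCopy T) L × 1ℚ - δ ≤ totalWeight n p L
    rainbow-likely =
        filter hits? (allVecs (allMaybe n) (length (pairs n)))
      , Unique.filter⁺ hits? (allVecs-unique (allMaybe-unique n) (length (pairs n)))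
      , All.map (λ {ω} → hit-rainbow T sk ω) (all-filter hits? (allVecs (allMaybe n) (length (pairs n))))
      , ≤-trans rainbow-heavy (≤-reflexive (≡.sym (totalWeight-E n p hits?)))

-- Choice of the constants

open import Defs
open import Data.Nat as ℕ using (ℕ; _≤_; suc; s≤s; z≤n)
open import Data.Integer using (+_)
open import Data.Rational as ℚ using (ℚ; 0ℚ; 1ℚ; _/_)
open import Data.Product using (Σ; _×_; _,_; ∃; ∃-syntax; proj₁; proj₂)
open import Data.List using (List)
open import Data.List.Relation.Unary.All using (All)
open import Data.List.Relation.Unary.Unique.Propositional using (Unique)
import Data.Nat.Properties as ℕ
open Exchanging using (fromℕ)
open Coordinates using (skeleton)
open Likelihood

theorem1p1 : (ε : ℚ) → 0ℚ ℚ.< ε →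
  (d : ℕ) → 2 ≤ d →
  (p : ℕ → ℚ) → (∀ n → 0ℚ ℚ.≤ p n × p n ℚ.≤ 1ℚ) →
  (∀ (M : ℕ) → ∃[ N ] (∀ n → N ≤ n → (+ M / 1) ℚ.≤ (+ n / 1) ℚ.* p n)) →
  (k : ℕ → ℕ) → (T : (n : ℕ) → Graph (k n)) →
  (∀ n → IsTree (T n)) →
  (∀ n → MaxDegreeAtMost (T n) d) →
  (∀ n → (+ k n / 1) ℚ.≤ (1ℚ ℚ.- ε) ℚ.* (+ n / 1)) →
  ∀ (δ : ℚ) → 0ℚ ℚ.< δ →
  ∃[ N ] (∀ n → N ≤ n →
    Σ (List (Outcome n)) λ L →
      Unique L × All (RainbowCopy (T n)) L × (1ℚ ℚ.- δ) ℚ.≤ totalWeight n (p n) L)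
theorem1p1 ε 0<ε d 2≤d p p∈[0,1] dense k T trees degrees sizes δ 0<δ =
  -- The first bound makes np at least `M`; the second makes n / s at least c + 1.
  proj₁ (dense M) ℕ.⊔ s ℕ.* suc c , λ n N≤n →
    conclude n (proj₂ (dense M) n (ℕ.≤-trans (ℕ.m≤m⊔n _ _) N≤n)) (ℕ.≤-trans (ℕ.m≤n⊔m (proj₁ (dense M)) _) N≤n)
  where
  t = proj₁ (archimedean ε 0<ε)
  c = proj₁ (archimedean δ 0<δ)
  K = 3 ℕ.* d ℕ.+ 7
  -- With this `s` the waste K · m of the embedding is at most n / t, the part of the vertex set
  -- that the tree leaves free.
  s = K ℕ.* t
  instance
    t≢0 : ℕ.NonZero t
    t≢0 = proj₁ (proj₂ (archimedean ε 0<ε))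
    c≢0 : ℕ.NonZero c
    c≢0 = proj₁ (proj₂ (archimedean δ 0<δ))
    s≢0 : ℕ.NonZero s
    s≢0 = ℕ.m*n≢0 K t {{ℕ.>-nonZero (ℕ.≤-trans (s≤s z≤n) (ℕ.m≤n+m 7 (3 ℕ.* d)))}}
  M = (s ℕ.+ s) ℕ.* t ℕ.* (2 ℕ.* 16 ℕ.^ s)
  conclude : ∀ n → fromℕ M ℚ.≤ fromℕ n ℚ.* p n → s ℕ.* suc c ≤ n →
    Σ (List (Outcome n)) λ L → Unique L × All (RainbowCopy (T n)) L × 1ℚ ℚ.- δ ℚ.≤ totalWeight n (p n) L
  conclude n M≤np large =
    rainbow-likely (T n) (skeleton (T n) (trees n) d (ℕ.≤-trans (s≤s z≤n) 2≤d) (degrees n)) n m s t c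
      (p n) δ (proj₁ (p∈[0,1] n)) (proj₂ (p∈[0,1] n)) (proj₂ (proj₂ (archimedean δ 0<δ)))
      (proj₁ (proj₂ mb)) (proj₂ (proj₂ (proj₂ mb))) M≤np tk+n≤tn
      (embedding-room K t (k n) m n tk+n≤tn (proj₁ (proj₂ (proj₂ mb))))
    where
    mb = blocks s c n large
    m = proj₁ mb
    instance
      n≢0 : ℕ.NonZero n
      n≢0 = ℕ.>-nonZero (ℕ.≤-trans (ℕ.>-nonZero⁻¹ s) (ℕ.≤-trans (ℕ.m≤m*n s (suc c)) large))
    tk+n≤tn : t ℕ.* k n ℕ.+ n ≤ t ℕ.* n
    tk+n≤tn = proportion t (k n) n (proj₂ (proj₂ (archimedean ε 0<ε))) (sizes n)
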